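{- Let $k\geq 0$ be an integer and let $G$ be a finite graph with at most $k$ vertex disjoint cycles. Then \[ \mathbf{c}(G)\leq \ell(g(1))\,\ell(g(2))\cdots \ell(g(k)). \] (For $k=0$ the empty product is $1$.)
   Context: Graphs are finite and simple. The independence complex $\mathrm{Ind}(G)$ is the set of independent vertex sets of $G$ (including the empty set), as a poset under inclusion. A matching on this poset is a set of disjoint pairs $\{\sigma,\sigma\cup\{v\}\}$ with $v\notin\sigma$; a cycle in it is a sequence of $m>1$ distinct matched pairs $\{\sigma_1\subset\tau_1\},\ldots,\{\sigma_m\subset\tau_m\}$ with $\tau_i\supset\sigma_{i+1}$ for $1\le i<m$ and $\tau_m\supset\sigma_1$; acyclic means no cycle. Unmatched elements are critical, and $\mathbf{c}(G)$ is the minimal number of critical elements of an acyclic matching on $\mathrm{Ind}(G)$. Lucas numbers: $\varphi(0)=0,\varphi(1)=1,\varphi(n)=\varphi(n-1)+\varphi(n-2)$, $\ell(n)=\varphi(n-1)+\varphi(n+1)$. The effective girth of a graph is the smallest number of vertices of degree at least three lying on a common cycle. For an integer $k\geq1$, $g(k)$ denotes the maximal effective girth of a graph of minimal degree at least two with at most $k$ vertex disjoint cycles. -}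

module Defs where

open import Data.Nat using (ℕ; zero; suc; _+_; _*_; _≤_)
open import Data.Bool using (Bool; true; false; _∧_; not; T)
open import Data.Fin using (Fin)
open import Data.Fin.Subset using (Subset; _∪_; ⁅_⁆; _⊃_) renaming (_∈_ to _∈ₛ_; _∉_ to _∉ₛ_)
open import Data.Vec using (Vec; []; _∷_)
import Data.Vec.Properties as VP
open import Data.List using (List; []; _∷_; length; filter; map; concatMap; take; _++_; allFin)
open import Data.Bool.ListAction using (all)
open import Data.List.Relation.Unary.All using (All)
open import Data.List.Relation.Unary.Unique.Propositional using (Unique)
open import Data.List.Relation.Unary.Linked using (Linked)
open import Data.List.Relation.Unary.AllPairs using (AllPairs)
open import Data.List.Membership.Propositional using (_∈_; _∉_)
import Data.List.Membership.DecPropositional as DecMem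
open import Data.Product using (Σ; ∃; _×_; _,_; proj₁; proj₂)
open import Relation.Binary.PropositionalEquality using (_≡_)
open import Relation.Nullary using (¬_)
open import Relation.Nullary.Decidable using (_×-dec_; ¬?)
open import Relation.Unary using (Decidable)
import Data.Bool.Properties as BP

-- Fibonacci and Lucas numbers
-- φ(0)=0, φ(1)=1, φ(n)=φ(n-1)+φ(n-2);  ℓ(n) = φ(n-1) + φ(n+1),
-- with φ(-1) = 1 (the Fibonacci recursion extended backwards), so ℓ(0) = 2.

fib : ℕ → ℕ
fib zero = zero
fib (suc zero) = suc zero
fib (suc (suc n)) = fib (suc n) + fib n

lucas : ℕ → ℕ
lucas zero = 2
lucas (suc n) = fib n + fib (suc (suc n))

record Graph (n : ℕ) : Set where
  field
    adj   : Fin n → Fin n → Bool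
    sym   : ∀ u v → adj u v ≡ adj v u
    irrefl : ∀ v → adj v v ≡ false
open Graph public

module _ {n : ℕ} (G : Graph n) where

  degree : Fin n → ℕ
  degree v = length (filter (λ u → T? (adj G v u)) (allFin n))
    where open import Data.Bool using (T?)

  MinDegreeAtLeast2 : Set
  MinDegreeAtLeast2 = ∀ v → 2 ≤ degree v

  IsCycle : List (Fin n) → Set
  IsCycle vs = (3 ≤ length vs) × Unique vs
             × Linked (λ u v → T (adj G u v)) (vs ++ take 1 vs)

  Cycle : Set
  Cycle = Σ (List (Fin n)) IsCycle

  VertexDisjoint : Cycle → Cycle → Set
  VertexDisjoint (c , _) (d , _) = ∀ v → v ∈ c → v ∉ d

  AtMostDisjointCycles : ℕ → Set
  AtMostDisjointCycles k =
    ¬ (Σ (List Cycle) λ cs → (length cs ≡ suc k) × AllPairs VertexDisjoint cs)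

  highDegreeOn : List (Fin n) → ℕ
  highDegreeOn vs = length (filter (λ v → 3 ≤? degree v) vs)
    where open import Data.Nat using (_≤?_)

  EffectiveGirth : ℕ → Set
  EffectiveGirth e = (Σ Cycle λ c → highDegreeOn (proj₁ c) ≡ e)
                   × (∀ (c : Cycle) → e ≤ highDegreeOn (proj₁ c))

  independent : Subset n → Bool
  independent σ = all (λ u → all (λ v → not (lookupB σ u ∧ lookupB σ v ∧ adj G u v)) (allFin n)) (allFin n)
    where lookupB : Subset n → Fin n → Bool
          lookupB s i = Data.Vec.lookup s i
            where import Data.Vec

  -- a matched pair {σ, σ ∪ {v}} is represented as (σ , v)
  Pair : Set
  Pair = Subset n × Fin n

  lower upper : Pair → Subset n
  lower (σ , v) = σ
  upper (σ , v) = σ ∪ ⁅ v ⁆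

  ValidPair : Pair → Set
  ValidPair (σ , v) = T (independent σ) × v ∉ₛ σ × T (independent (σ ∪ ⁅ v ⁆))

  elems : List Pair → List (Subset n)
  elems = concatMap (λ p → lower p ∷ upper p ∷ [])

  IsMatching : List Pair → Set
  IsMatching M = All ValidPair M × Unique (elems M)

  MatchingCycle : List Pair → Set
  MatchingCycle M = Σ (List Pair) λ ps →
      (2 ≤ length ps) × Unique ps × All (_∈ M) ps
    × Linked (λ p q → upper p ⊃ lower q) (ps ++ take 1 ps)

  IsAcyclicMatching : List Pair → Set
  IsAcyclicMatching M = IsMatching M × ¬ MatchingCycle M

  allSubsets : (m : ℕ) → List (Subset m)
  allSubsets zero = [] ∷ []
  allSubsets (suc m) = map (true ∷_) (allSubsets m) ++ map (false ∷_) (allSubsets m)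

  private
    _≟ₛ_ : (a b : Subset n) → Relation.Nullary.Dec (a ≡ b)
    _≟ₛ_ = VP.≡-dec BP._≟_
      where import Relation.Nullary
    module DM = DecMem _≟ₛ_

  critical? : (M : List Pair) → Decidable (λ σ → T (independent σ) × σ ∉ elems M)
  critical? M σ = T? (independent σ) ×-dec ¬? (σ DM.∈? elems M)
    where open import Data.Bool using (T?)

  numCritical : List Pair → ℕ
  numCritical M = length (filter (critical? M) (allSubsets n))

  -- c(G) ≤ B : some acyclic matching on Ind(G) has at most B critical elements
  -- (c(G) is the minimum of numCritical over acyclic matchings)
  cBoundedBy : ℕ → Set
  cBoundedBy B = Σ (List Pair) λ M → IsAcyclicMatching M × numCritical M ≤ B

IsMaxEffGirth : ℕ → ℕ → Set
IsMaxEffGirth k m =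
    (Σ ℕ λ n → Σ (Graph n) λ G →
        MinDegreeAtLeast2 G × AtMostDisjointCycles G k × EffectiveGirth G m)
  × (∀ n (G : Graph n) e → MinDegreeAtLeast2 G → AtMostDisjointCycles G k →
        EffectiveGirth G e → e ≤ m)

lucasProd : (ℕ → ℕ) → ℕ → ℕ
lucasProd g zero = 1
lucasProd g (suc k) = lucasProd g k * lucas (g (suc k))

{-# OPTIONS --safe #-}
-- Splitting the independent sets by whether they contain v gives c(G) ≤ c(G ∖ v) + c(G ∖ N[v]),
-- and c(G) = 0 if G has an isolated vertex; hence c(G) ≤ c(G ∖ N[b]) if b is the neighbour of a
-- leaf. So vertices of degree at most one cost nothing, and otherwise G has a cycle C with
-- e ≤ g(k) vertices of degree at least three ("high"). Branch over the high vertices along C.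
-- The other ("low") vertices of C are resolved by the leaf rule, and between two consecutive high
-- vertices x, y at least one choice for x (deleting x or N[x]) removes y without branching: which
-- one depends on the number of low vertices between them modulo 3. So a path with h high
-- vertices costs φ(h + 2) leaves, the whole cycle at most φ(e - 1) + φ(e + 1) = ℓ(e), and in
-- every leaf C is gone, leaving at most k - 1 disjoint cycles.
module Submission where

open import Defs renaming (sym to adj-sym)
open import Data.Nat using (ℕ; zero; suc; _+_; _*_; _∸_; _≤_; _<_; z≤n; s≤s; _≤?_)
import Data.Nat.Properties as ℕₚ
open import Data.Nat.Induction using (<-wellFounded)
open import Induction.WellFounded using (Acc; acc)
open import Data.Bool using (Bool; true; false; _∧_; not; T; if_then_else_)
import Data.Bool.Properties as Boolₚ
open import Data.Fin using (Fin; zero; suc; toℕ; fromℕ<)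
import Data.Fin.Properties as Finₚ
open import Data.Fin.Subset using (Subset; _∪_; ⁅_⁆; _⊃_; _⊆_; _─_; _-_) renaming (_∈_ to _∈ₛ_; _∉_ to _∉ₛ_; ⊥ to ∅)
import Data.Fin.Subset.Properties as Subsetₚ
open import Data.Vec using ([]; _∷_)
import Data.Vec as Vec
import Data.Vec.Properties as Vecₚ
open import Data.List using (List; []; _∷_; length; filter; map; take; drop; _++_; allFin; lookup; initLast; _∷ʳ′_)
import Data.List.Properties as Listₚ
open import Data.List.Relation.Unary.All as All using (All; []; _∷_)
import Data.List.Relation.Unary.All.Properties as Allₚ
open import Data.List.Relation.Unary.Any using (here; there; index)
import Data.List.Relation.Unary.Any.Properties as Anyₚ
open import Data.List.Relation.Unary.AllPairs as AllPairs using (AllPairs; []; _∷_)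
import Data.List.Relation.Unary.AllPairs.Properties as AllPairsₚ
open import Data.List.Relation.Unary.Unique.Propositional using (Unique)
import Data.List.Relation.Unary.Unique.Propositional.Properties as Uniqueₚ
import Data.List.Relation.Unary.Unique.DecPropositional as DecUnique
open import Data.List.Relation.Unary.Linked as Linked using (Linked; []; [-]; _∷_)
import Data.List.Relation.Unary.Linked.Properties as Linkedₚ
import Data.List.Membership.DecPropositional as DecMembership
open import Data.List.Membership.Propositional using (_∈_; _∉_)
open import Data.List.Membership.Propositional.Properties using (∈-++⁺ˡ; ∈-++⁺ʳ; ∈-++⁻; ∈-map⁺; ∈-map⁻; ∈-filter⁺; ∈-filter⁻; ∈-allFin; ∈-∃++; ∈-lookup)
open import Data.Product using (Σ; ∃; _×_; _,_; proj₁; proj₂)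
open import Data.Sum using (_⊎_; inj₁; inj₂)
open import Data.Unit using (⊤)
open import Data.Empty using (⊥-elim)
open import Function using (_∘_; case_of_)
open import Relation.Binary.PropositionalEquality using (_≡_; _≢_; refl; sym; trans; cong; cong₂; subst)
open import Relation.Nullary using (¬_; Dec; yes; no; does)
open import Relation.Nullary.Decidable using (⌊_⌋; _×-dec_; _⊎-dec_; _→-dec_; ¬?; map′; dec-true)

-- Matching trees and the acyclic matchings they define

-- The Fibonacci bound for paths alone does not close the cycle. Let e ≥ 2, let `s` be a high vertex
-- and `t` its predecessor on the cycle. Deleting `s` leaves a path with e - 1 high vertices; taking
-- `s` removes `t` as well. If `t` is high, the second path has e - 2 high vertices, and as one of
-- the two paths loses its first high vertex for free, the sum is φ(e - 1) + φ(e + 1) or 2φ(e). If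
-- `t` is low, both paths have e - 1 high vertices and the sum would be φ(e) + φ(e + 1). The saving
-- then comes from the far end: the low runs after the last high vertex `z` of the two paths have
-- consecutive lengths, so one length is not divisible by 3. In that path one of the choices at `z`
-- ends in an isolated vertex, and `z` costs nothing. Chords between high vertices may remove
-- further high vertices, so presence is always tested and the bounds are monotone in the number of
-- high vertices.

module _ {A : Set} where

  Unique-⊆⇒length≤ : ∀ {xs ys : List A} → Unique xs → (∀ {x} → x ∈ xs → x ∈ ys) → length xs ≤ length ys
  Unique-⊆⇒length≤ {[]} _ _ = z≤n
  Unique-⊆⇒length≤ {x ∷ xs} (x∉ ∷ u) ⊆ys with ∈-∃++ (⊆ys (here refl))
  ... | as , bs , refl = subst (suc (length xs) ≤_) (sym len)
        (s≤s (Unique-⊆⇒length≤ u (λ y∈ → drop-x (⊆ys (there y∈)) (λ y≡x → All.lookup x∉ y∈ (sym y≡x)))))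
    where
    len : length (as ++ x ∷ bs) ≡ suc (length (as ++ bs))
    len = trans (Listₚ.length-++ as) (trans (ℕₚ.+-suc _ _) (cong suc (sym (Listₚ.length-++ as))))
    drop-x : ∀ {y} → y ∈ as ++ x ∷ bs → y ≢ x → y ∈ as ++ bs
    drop-x y∈ y≢x with ∈-++⁻ as y∈
    ... | inj₁ y∈as = ∈-++⁺ˡ y∈as
    ... | inj₂ (here y≡x) = ⊥-elim (y≢x y≡x)
    ... | inj₂ (there y∈bs) = ∈-++⁺ʳ as y∈bs

  -- Walking round the list leads from any entry to the head and from the head to any entry.
  -- Monotone quantities on a closed gradient path are thereby constant.
  closed-chain : ∀ {R : A → A → Set} → (∀ {x y z} → R x y → R y z → R x z) →
    ∀ ps → Linked R (ps ++ take 1 ps) → ∀ {p q} → p ∈ ps → q ∈ ps → R p q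
  closed-chain {R} tr (x ∷ xs) l p∈ q∈ = tr (to p∈) (from q∈)
    where
    pairs : AllPairs R (x ∷ xs ++ x ∷ [])
    pairs = Linkedₚ.Linked⇒AllPairs tr l
    x→ : ∀ {y} → y ∈ xs ++ x ∷ [] → R x y
    x→ = All.lookup (AllPairs.head pairs)
    →x : ∀ {y} zs → AllPairs R (zs ++ x ∷ []) → y ∈ zs → R y x
    →x (z ∷ zs) (r ∷ _) (here refl) = All.lookup r (∈-++⁺ʳ zs (here refl))
    →x (z ∷ zs) (_ ∷ rs) (there y∈) = →x zs rs y∈
    from : ∀ {y} → y ∈ x ∷ xs → R x y
    from (here refl) = x→ (∈-++⁺ʳ xs (here refl))
    from (there y∈) = x→ (∈-++⁺ˡ y∈)
    to : ∀ {y} → y ∈ x ∷ xs → R y x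
    to (here refl) = x→ (∈-++⁺ʳ xs (here refl))
    to (there y∈) = →x xs (AllPairs.tail pairs) y∈

  All-relink : ∀ {R S : A → A → Set} {P : A → Set} → (∀ {x y} → P x → P y → R x y → S x y) →
    ∀ {ps} → All P ps → Linked R ps → Linked S ps
  All-relink f _ [] = []
  All-relink f _ [-] = [-]
  All-relink f (p ∷ q ∷ ps) (r ∷ l) = f p q r ∷ All-relink f (q ∷ ps) l

module _ {n : ℕ} where

  _∋_ : (Fin n → Bool) → Fin n → Set
  W ∋ x = W x ≡ true

  _∋?_ : ∀ W x → Dec (W ∋ x)
  W ∋? x = W x Boolₚ.≟ true

  _⊆ᵇ_ : (Fin n → Bool) → (Fin n → Bool) → Set
  V ⊆ᵇ W = ∀ {x} → V ∋ x → W ∋ x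

  del : Fin n → (Fin n → Bool) → (Fin n → Bool)
  del v W x = W x ∧ not ⌊ x Finₚ.≟ v ⌋

  del⁻ : ∀ {v W x} → del v W ∋ x → W ∋ x × x ≢ v
  del⁻ {v} {W} {x} p with W x | x Finₚ.≟ v
  ... | true | no x≢v = refl , x≢v

  del⁺ : ∀ {v W x} → W ∋ x → x ≢ v → del v W ∋ x
  del⁺ {v} {W} {x} Wx x≢v rewrite Wx with x Finₚ.≟ v
  ... | yes x≡v = ⊥-elim (x≢v x≡v)
  ... | no _ = refl

module _ {n : ℕ} where

  ∈-∪⁅⁆⁻ : ∀ {I : Subset n} {v x} → x ∈ₛ I ∪ ⁅ v ⁆ → x ∈ₛ I ⊎ x ≡ v
  ∈-∪⁅⁆⁻ {I} {v} x∈ with Subsetₚ.x∈p∪q⁻ I ⁅ v ⁆ x∈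
  ... | inj₁ x∈I = inj₁ x∈I
  ... | inj₂ x∈v = inj₂ (Subsetₚ.x∈⁅y⁆⇒x≡y v x∈v)

  ∈-∪⁅⁆⁺ˡ : ∀ {I : Subset n} {v x} → x ∈ₛ I → x ∈ₛ I ∪ ⁅ v ⁆
  ∈-∪⁅⁆⁺ˡ x∈ = Subsetₚ.x∈p∪q⁺ (inj₁ x∈)

  ∈-∪⁅⁆⁺ʳ : ∀ {I : Subset n} v → v ∈ₛ I ∪ ⁅ v ⁆
  ∈-∪⁅⁆⁺ʳ v = Subsetₚ.x∈p∪q⁺ (inj₂ (Subsetₚ.x∈⁅x⁆ v))

  ∪⁅⁆-cancel : ∀ {σ τ : Subset n} {v} → v ∉ₛ σ → v ∉ₛ τ → σ ∪ ⁅ v ⁆ ≡ τ ∪ ⁅ v ⁆ → σ ≡ τ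
  ∪⁅⁆-cancel v∉σ v∉τ eq = Subsetₚ.⊆-antisym (half v∉σ eq) (half v∉τ (sym eq))
    where
    half : ∀ {σ τ : Subset n} {v} → v ∉ₛ σ → σ ∪ ⁅ v ⁆ ≡ τ ∪ ⁅ v ⁆ → σ ⊆ τ
    half {σ} {τ} {v} v∉ eq {x} x∈ with ∈-∪⁅⁆⁻ {τ} {v} (subst (x ∈ₛ_) eq (∈-∪⁅⁆⁺ˡ x∈))
    ... | inj₁ x∈τ = x∈τ
    ... | inj₂ refl = ⊥-elim (v∉ x∈)

x∈q⇒x∉p─q : ∀ {n} (p : Subset n) {q : Subset n} {x} → x ∈ₛ q → x ∉ₛ p ─ q
x∈q⇒x∉p─q (true ∷ p) Vec.here ()
x∈q⇒x∉p─q (false ∷ p) Vec.here ()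
x∈q⇒x∉p─q (_ ∷ p) (Vec.there x∈q) (Vec.there x∈) = x∈q⇒x∉p─q p x∈q x∈

T⇒≡true : ∀ {b} → T b → b ≡ true
T⇒≡true {true} _ = refl

≡true⇒T : ∀ {b} → b ≡ true → T b
≡true⇒T refl = _

allSubsets-complete : ∀ {n} (G : Graph n) m (σ : Subset m) → σ ∈ allSubsets G m
allSubsets-complete G zero [] = here refl
allSubsets-complete G (suc m) (true ∷ σ) = ∈-++⁺ˡ (∈-map⁺ _ (allSubsets-complete G m σ))
allSubsets-complete G (suc m) (false ∷ σ) = ∈-++⁺ʳ _ (∈-map⁺ _ (allSubsets-complete G m σ))

allSubsets-unique : ∀ {n} (G : Graph n) m → Unique (allSubsets G m)
allSubsets-unique G zero = [] ∷ []
allSubsets-unique G (suc m) = Uniqueₚ.++⁺ (Uniqueₚ.map⁺ Vecₚ.∷-injectiveʳ u) (Uniqueₚ.map⁺ Vecₚ.∷-injectiveʳ u) disj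
  where
  u = allSubsets-unique G m
  disj : ∀ {σ} → ¬ (σ ∈ map (true ∷_) (allSubsets G m) × σ ∈ map (false ∷_) (allSubsets G m))
  disj (p , q) with ∈-map⁻ _ p | ∈-map⁻ _ q
  ... | _ , _ , refl | _ , _ , ()

module _ {n : ℕ} (G : Graph n) where

  adj-true-sym : ∀ {u v} → adj G u v ≡ true → adj G v u ≡ true
  adj-true-sym {u} {v} = trans (adj-sym G v u)

  adj⇒≢ : ∀ {u v} → adj G u v ≡ true → u ≢ v
  adj⇒≢ {u} uv refl with trans (sym uv) (irrefl G u)
  ... | ()

  -- Named after complexes: the independent sets of what remains form the link of `v` in the
  -- independence complex of `W`.
  link : Fin n → (Fin n → Bool) → (Fin n → Bool)
  link v W x = del v W x ∧ not (adj G v x)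

  link⁻ : ∀ {v W x} → link v W ∋ x → W ∋ x × x ≢ v × ¬ adj G v x ≡ true
  link⁻ {v} {W} {x} p with del v W x in eq | adj G v x
  ... | true | false = proj₁ (del⁻ {v = v} {W} eq) , proj₂ (del⁻ {v = v} {W} eq) , λ ()

  link⁺ : ∀ {v W x} → W ∋ x → x ≢ v → ¬ adj G v x ≡ true → link v W ∋ x
  link⁺ {v} {W} {x} Wx x≢v ¬a rewrite del⁺ {v = v} {W} Wx x≢v with adj G v x
  ... | true = ⊥-elim (¬a refl)
  ... | false = refl

  -- A certificate for c(G[W]) ≤ b, where W is the set of remaining vertices.
  data Tree (W : Fin n → Bool) (b : ℕ) : Set where
    void : (∀ x → ¬ W ∋ x) → 1 ≤ b → Tree W b
    -- Any `b`, in particular 0: adding or removing `v` matches all the sets.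
    isolated : ∀ v → W ∋ v → (∀ {x} → W ∋ x → ¬ adj G v x ≡ true) → Tree W b
    branch : ∀ v {a c} → W ∋ v → Tree (del v W) a → Tree (link v W) c → a + c ≤ b → Tree W b

  weaken : ∀ {W a b} → a ≤ b → Tree W a → Tree W b
  weaken a≤b (void e 1≤) = void e (ℕₚ.≤-trans 1≤ a≤b)
  weaken a≤b (isolated v Wv i) = isolated v Wv i
  weaken a≤b (branch v Wv s t ≤a) = branch v Wv s t (ℕₚ.≤-trans ≤a a≤b)

  leaf : ∀ {W a b B} → W ∋ a → W ∋ b → adj G a b ≡ true →
    (∀ {x} → W ∋ x → adj G a x ≡ true → x ≡ b) → Tree (link b W) B → Tree W B
  leaf {W} {a} {b} Wa Wb ab only t =
    branch b {0} Wb
      (isolated a (del⁺ {W = W} Wa (adj⇒≢ ab))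
        (λ x∈ ax → proj₂ (del⁻ {W = W} x∈) (only (proj₁ (del⁻ {W = W} x∈)) ax)))
      t ℕₚ.≤-refl

  Independent : Subset n → Set
  Independent σ = ∀ {u v} → u ∈ₛ σ → v ∈ₛ σ → ¬ adj G u v ≡ true

  independent⁻ : ∀ {σ} → T (independent G σ) → Independent σ
  independent⁻ {σ} ind {u} {v} u∈ v∈ uv = absurd
    (All.lookup (Allₚ.all⁺ _ (allFin n) (All.lookup (Allₚ.all⁺ _ (allFin n) ind) (∈-allFin u))) (∈-allFin v))
    where
    absurd : ¬ T (not (Vec.lookup σ u ∧ Vec.lookup σ v ∧ adj G u v))
    absurd t rewrite Vecₚ.[]=⇒lookup u∈ | Vecₚ.[]=⇒lookup v∈ | uv = t

  independent⁺ : ∀ {σ} → Independent σ → T (independent G σ)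
  independent⁺ {σ} ind = Allₚ.all⁻ _ (All.tabulate {xs = allFin n} λ {u} _ → Allₚ.all⁻ _ (All.tabulate {xs = allFin n} λ {v} _ → ok u v))
    where
    ok : ∀ u v → T (not (Vec.lookup σ u ∧ Vec.lookup σ v ∧ adj G u v))
    ok u v with Vec.lookup σ u in u∈ | Vec.lookup σ v in v∈ | adj G u v in uv
    ... | false | _ | _ = _
    ... | true | false | _ = _
    ... | true | true | false = _
    ... | true | true | true = ⊥-elim (ind (Vecₚ.lookup⇒[]= u σ u∈) (Vecₚ.lookup⇒[]= v σ v∈) uv)

  -- The independent sets that agree with the decisions taken so far. Given `Separated I W`,
  -- stripping off an independent `I` identifies them with those of the graph induced on `W`.
  Cell : Subset n → (Fin n → Bool) → Subset n → Set
  Cell I W σ = T (independent G σ) × I ⊆ σ × (∀ x → x ∈ₛ σ → x ∈ₛ I ⊎ W ∋ x)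

  cell? : ∀ I W σ → Dec (Cell I W σ)
  cell? I W σ = Boolₚ.T? _ ×-dec (I Subsetₚ.⊆? σ)
    ×-dec Finₚ.all? (λ x → (x Subsetₚ.∈? σ) →-dec ((x Subsetₚ.∈? I) ⊎-dec (W ∋? x)))

  bottom? : ∀ I W v σ → Dec (Cell I W σ × v ∉ₛ σ)
  bottom? I W v σ = cell? I W σ ×-dec ¬? (v Subsetₚ.∈? σ)

  matching : ∀ {W b} → Tree W b → Subset n → List (Pair G)
  matching (void _ _) I = []
  matching {W} (isolated v _ _) I = map (_, v) (filter (bottom? I W v) (allSubsets G n))
  matching (branch v _ s t _) I = matching s I ++ matching t (I ∪ ⁅ v ⁆)

  critical : ∀ {W b} → Tree W b → Subset n → List (Subset n)
  critical (void _ _) I = I ∷ []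
  critical (isolated _ _ _) I = []
  critical (branch v _ s t _) I = critical s I ++ critical t (I ∪ ⁅ v ⁆)

  length-critical : ∀ {W b} (t : Tree W b) I → length (critical t I) ≤ b
  length-critical (void _ 1≤b) I = 1≤b
  length-critical (isolated _ _ _) I = z≤n
  length-critical (branch v _ s t a+c≤b) I = ℕₚ.≤-trans
    (ℕₚ.≤-trans (ℕₚ.≤-reflexive (Listₚ.length-++ (critical s I)))
      (ℕₚ.+-mono-≤ (length-critical s I) (length-critical t (I ∪ ⁅ v ⁆)))) a+c≤b

  -- I is the set of vertices taken so far, W the set of undecided ones.
  Separated : Subset n → (Fin n → Bool) → Set
  Separated I W = ∀ {x} → x ∈ₛ I → ¬ W ∋ x × (∀ {y} → W ∋ y → ¬ adj G x y ≡ true)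

  separated-del : ∀ {I W v} → Separated I W → Separated I (del v W)
  separated-del {I} {W} sep x∈ = (λ p → proj₁ (sep x∈) (proj₁ (del⁻ {W = W} p)))
    , λ p → proj₂ (sep x∈) (proj₁ (del⁻ {W = W} p))

  separated-link : ∀ {I W v} → Separated I W → Separated (I ∪ ⁅ v ⁆) (link v W)
  separated-link {I} {W} {v} sep {x} x∈ = split (∈-∪⁅⁆⁻ x∈)
    where
    split : x ∈ₛ I ⊎ x ≡ v → ¬ link v W ∋ x × (∀ {y} → link v W ∋ y → ¬ adj G x y ≡ true)
    split (inj₁ x∈I) = (λ p → proj₁ (sep x∈I) (proj₁ (link⁻ {W = W} p)))
      , λ p → proj₂ (sep x∈I) (proj₁ (link⁻ {W = W} p))
    split (inj₂ refl) = (λ p → proj₁ (proj₂ (link⁻ {W = W} p)) refl) , λ p → proj₂ (proj₂ (link⁻ {W = W} p))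

  module _ {I : Subset n} {W : Fin n → Bool} {v : Fin n} (sep : Separated I W) (Wv : W ∋ v) where

    cell-del⁻ : ∀ {σ} → Cell I (del v W) σ → Cell I W σ × v ∉ₛ σ
    cell-del⁻ {σ} (ind , I⊆ , ⊆W) = (ind , I⊆ , λ x x∈ → out x (⊆W x x∈)) , ∉
      where
      out : ∀ x → x ∈ₛ I ⊎ del v W ∋ x → x ∈ₛ I ⊎ W ∋ x
      out x (inj₁ p) = inj₁ p
      out x (inj₂ p) = inj₂ (proj₁ (del⁻ {W = W} p))
      ∉ : v ∉ₛ σ
      ∉ v∈ with ⊆W v v∈
      ... | inj₁ v∈I = proj₁ (sep v∈I) Wv
      ... | inj₂ p = proj₂ (del⁻ {W = W} p) refl

    cell-del⁺ : ∀ {σ} → Cell I W σ → v ∉ₛ σ → Cell I (del v W) σ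
    cell-del⁺ {σ} (ind , I⊆ , ⊆W) v∉ = ind , I⊆ , λ x x∈ → out x x∈ (⊆W x x∈)
      where
      out : ∀ x → x ∈ₛ σ → x ∈ₛ I ⊎ W ∋ x → x ∈ₛ I ⊎ del v W ∋ x
      out x x∈ (inj₁ p) = inj₁ p
      out x x∈ (inj₂ p) = inj₂ (del⁺ {W = W} p λ { refl → v∉ x∈ })

    cell-link⁻ : ∀ {σ} → Cell (I ∪ ⁅ v ⁆) (link v W) σ → Cell I W σ × v ∈ₛ σ
    cell-link⁻ {σ} (ind , I⊆ , ⊆W) = (ind , I⊆ ∘ ∈-∪⁅⁆⁺ˡ , λ x x∈ → out x (⊆W x x∈)) , I⊆ (∈-∪⁅⁆⁺ʳ v)
      where
      out : ∀ x → x ∈ₛ I ∪ ⁅ v ⁆ ⊎ link v W ∋ x → x ∈ₛ I ⊎ W ∋ x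
      out x (inj₁ p) with ∈-∪⁅⁆⁻ p
      ... | inj₁ q = inj₁ q
      ... | inj₂ refl = inj₂ Wv
      out x (inj₂ p) = inj₂ (proj₁ (link⁻ {W = W} p))

    cell-link⁺ : ∀ {σ} → Cell I W σ → v ∈ₛ σ → Cell (I ∪ ⁅ v ⁆) (link v W) σ
    cell-link⁺ {σ} (ind , I⊆ , ⊆W) v∈ = ind , in′ , λ x x∈ → out x x∈ (⊆W x x∈)
      where
      in′ : I ∪ ⁅ v ⁆ ⊆ σ
      in′ x∈ with ∈-∪⁅⁆⁻ x∈
      ... | inj₁ q = I⊆ q
      ... | inj₂ refl = v∈
      out : ∀ x → x ∈ₛ σ → x ∈ₛ I ⊎ W ∋ x → x ∈ₛ I ∪ ⁅ v ⁆ ⊎ link v W ∋ x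
      out x x∈ (inj₁ p) = inj₁ (∈-∪⁅⁆⁺ˡ p)
      out x x∈ (inj₂ p) = case (x Finₚ.≟ v) of λ where
        (yes refl) → inj₁ (∈-∪⁅⁆⁺ʳ v)
        (no x≢v) → inj₂ (link⁺ {W = W} p x≢v (independent⁻ ind v∈ x∈))

    -- An edge at `v` would lead to `I` or to `W`; `sep` excludes the first and `iso` the second.
    cell-cone : (∀ {x} → W ∋ x → ¬ adj G v x ≡ true) → ∀ {σ} → Cell I W σ → Cell I W (σ ∪ ⁅ v ⁆)
    cell-cone iso {σ} (ind , I⊆ , ⊆W) = independent⁺ ind′ , ∈-∪⁅⁆⁺ˡ ∘ I⊆ , λ x x∈ → out x (∈-∪⁅⁆⁻ x∈)
      where
      out : ∀ x → x ∈ₛ σ ⊎ x ≡ v → x ∈ₛ I ⊎ W ∋ x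
      out x (inj₁ x∈) = ⊆W x x∈
      out x (inj₂ refl) = inj₂ Wv
      v≁ : ∀ {x} → x ∈ₛ σ → ¬ adj G v x ≡ true
      v≁ {x} x∈ vx with ⊆W x x∈
      ... | inj₁ x∈I = proj₂ (sep x∈I) Wv (adj-true-sym vx)
      ... | inj₂ Wx = iso Wx vx
      ind′ : Independent (σ ∪ ⁅ v ⁆)
      ind′ {x} {y} x∈ y∈ xy with ∈-∪⁅⁆⁻ x∈ | ∈-∪⁅⁆⁻ y∈
      ... | inj₁ p | inj₁ q = independent⁻ ind p q xy
      ... | inj₁ p | inj₂ refl = v≁ p (adj-true-sym xy)
      ... | inj₂ refl | inj₁ q = v≁ q xy
      ... | inj₂ refl | inj₂ refl = adj⇒≢ xy refl

  matching-cells : ∀ {W b} (t : Tree W b) {I} → Separated I W → ∀ {p} → p ∈ matching t I →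
    Cell I W (lower G p) × proj₂ p ∉ₛ lower G p × Cell I W (upper G p)
  matching-cells {W} (isolated v Wv iso) {I} sep p∈ with ∈-map⁻ (_, v) p∈
  ... | σ , σ∈ , refl with ∈-filter⁻ (bottom? I W v) {xs = allSubsets G n} σ∈
  ... | _ , cell , v∉ = cell , v∉ , cell-cone sep Wv iso cell
  matching-cells {W} (branch v Wv s t _) {I} sep p∈ with ∈-++⁻ (matching s I) p∈
  ... | inj₁ p∈s = let c , ∉ , c′ = matching-cells s (separated-del {W = W} sep) p∈s
                   in proj₁ (cell-del⁻ sep Wv c) , ∉ , proj₁ (cell-del⁻ sep Wv c′)
  ... | inj₂ p∈t = let c , ∉ , c′ = matching-cells t (separated-link {W = W} sep) p∈t
                   in proj₁ (cell-link⁻ sep Wv c) , ∉ , proj₁ (cell-link⁻ sep Wv c′)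

  elems-++ : ∀ M N → elems G (M ++ N) ≡ elems G M ++ elems G N
  elems-++ M N = Listₚ.concatMap-++ _ M N

  ∈-elems⁻ : ∀ {M σ} → σ ∈ elems G M → ∃ λ p → p ∈ M × (σ ≡ lower G p ⊎ σ ≡ upper G p)
  ∈-elems⁻ {p ∷ M} (here e) = p , here refl , inj₁ e
  ∈-elems⁻ {p ∷ M} (there (here e)) = p , here refl , inj₂ e
  ∈-elems⁻ {p ∷ M} (there (there σ∈)) = let q , q∈ , e = ∈-elems⁻ {M} σ∈ in q , there q∈ , e

  ∈-elems⁺ : ∀ {M p} → p ∈ M → lower G p ∈ elems G M × upper G p ∈ elems G M
  ∈-elems⁺ (here refl) = here refl , there (here refl)
  ∈-elems⁺ (there p∈) = let a , b = ∈-elems⁺ p∈ in there (there a) , there (there b)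

  elems-cells : ∀ {W b} (t : Tree W b) {I} → Separated I W → ∀ {σ} → σ ∈ elems G (matching t I) → Cell I W σ
  elems-cells t {I} sep σ∈ with ∈-elems⁻ {matching t I} σ∈
  ... | p , p∈ , inj₁ refl = proj₁ (matching-cells t sep p∈)
  ... | p , p∈ , inj₂ refl = proj₂ (proj₂ (matching-cells t sep p∈))

  -- Upper sets contain `v`, lower sets do not, and adding `v` is injective on sets without it.
  cone-elems-unique : ∀ {v σs} → Unique σs → All (v ∉ₛ_) σs → Unique (elems G (map (_, v) σs))
  cone-elems-unique [] [] = []
  cone-elems-unique {v} {σ ∷ σs} (σ∉ ∷ u) (v∉ ∷ v∉s) =
    All.tabulate fresh-lower ∷ All.tabulate fresh-upper ∷ cone-elems-unique u v∉s
    where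
    fresh-upper : ∀ {τ} → τ ∈ elems G (map (_, v) σs) → σ ∪ ⁅ v ⁆ ≢ τ
    fresh-upper τ∈ eq with ∈-elems⁻ {map (_, v) σs} τ∈
    ... | p , p∈ , e with ∈-map⁻ (_, v) p∈
    fresh-upper τ∈ refl | _ , p∈ , inj₁ e | ρ , ρ∈ , refl = All.lookup v∉s ρ∈ (subst (v ∈ₛ_) e (∈-∪⁅⁆⁺ʳ v))
    fresh-upper τ∈ refl | _ , p∈ , inj₂ e | ρ , ρ∈ , refl = All.lookup σ∉ ρ∈ (∪⁅⁆-cancel v∉ (All.lookup v∉s ρ∈) e)
    fresh-lower : ∀ {τ} → τ ∈ (σ ∪ ⁅ v ⁆) ∷ elems G (map (_, v) σs) → σ ≢ τ
    fresh-lower (here refl) eq = v∉ (subst (v ∈ₛ_) (sym eq) (∈-∪⁅⁆⁺ʳ v))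
    fresh-lower (there τ∈) eq with ∈-elems⁻ {map (_, v) σs} τ∈
    ... | p , p∈ , e with ∈-map⁻ (_, v) p∈
    fresh-lower (there τ∈) refl | _ , p∈ , inj₁ e | ρ , ρ∈ , refl = All.lookup σ∉ ρ∈ e
    fresh-lower (there τ∈) refl | _ , p∈ , inj₂ e | ρ , ρ∈ , refl = v∉ (subst (v ∈ₛ_) (sym e) (∈-∪⁅⁆⁺ʳ v))

  elems-unique : ∀ {W b} (t : Tree W b) {I} → Separated I W → Unique (elems G (matching t I))
  elems-unique (void _ _) sep = []
  elems-unique {W} (isolated v Wv iso) {I} sep = cone-elems-unique
    (Uniqueₚ.filter⁺ (bottom? I W v) (allSubsets-unique G n))
    (All.map proj₂ (Allₚ.all-filter (bottom? I W v) (allSubsets G n)))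
  elems-unique {W} (branch v Wv s t _) {I} sep =
    subst Unique (sym (elems-++ (matching s I) _))
      (Uniqueₚ.++⁺ (elems-unique s sepₛ) (elems-unique t sepₜ)
        λ (p , q) → proj₂ (cell-del⁻ sep Wv (elems-cells s sepₛ p)) (proj₂ (cell-link⁻ sep Wv (elems-cells t sepₜ q))))
    where
    sepₛ = separated-del {W = W} sep
    sepₜ = separated-link {W = W} sep

  covered : ∀ {W b} (t : Tree W b) {I} → Separated I W → ∀ {σ} → Cell I W σ →
    σ ∈ elems G (matching t I) ⊎ σ ∈ critical t I
  covered (void empty _) sep {σ} (_ , I⊆ , ⊆W) = inj₂ (here (Subsetₚ.⊆-antisym (λ {x} x∈ → in-I x (⊆W x x∈)) I⊆))
    where
    in-I : ∀ x → x ∈ₛ _ ⊎ _ ≡ true → x ∈ₛ _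
    in-I x (inj₁ p) = p
    in-I x (inj₂ Wx) = ⊥-elim (empty x Wx)
  covered {W} (isolated v Wv iso) {I} sep {σ} cell@(ind , I⊆ , ⊆W) with v Subsetₚ.∈? σ
  ... | no v∉ = inj₁ (proj₁ (∈-elems⁺ (∈-map⁺ (_, v) (∈-filter⁺ (bottom? I W v) (allSubsets-complete G n σ) (cell , v∉)))))
  ... | yes v∈ = inj₁ (subst (_∈ _) refill
                   (proj₂ (∈-elems⁺ (∈-map⁺ (_, v) (∈-filter⁺ (bottom? I W v) (allSubsets-complete G n σ′) (cell′ , v∉′))))))
    where
    σ′ = σ - v
    σ′⊆ : σ′ ⊆ σ
    σ′⊆ = Subsetₚ.p─q⊆p σ ⁅ v ⁆
    v∉′ : v ∉ₛ σ′
    v∉′ = x∈q⇒x∉p─q σ (Subsetₚ.x∈⁅x⁆ v)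
    cell′ : Cell I W σ′
    cell′ = independent⁺ (λ p q → independent⁻ ind (σ′⊆ p) (σ′⊆ q))
      , (λ x∈ → Subsetₚ.x∈p∧x≢y⇒x∈p-y (I⊆ x∈) λ { refl → proj₁ (sep x∈) Wv })
      , λ x x∈ → ⊆W x (σ′⊆ x∈)
    refill : σ′ ∪ ⁅ v ⁆ ≡ σ
    refill = Subsetₚ.⊆-antisym ⊆₁ ⊆₂
      where
      ⊆₁ : σ′ ∪ ⁅ v ⁆ ⊆ σ
      ⊆₁ x∈ with ∈-∪⁅⁆⁻ x∈
      ... | inj₁ p = σ′⊆ p
      ... | inj₂ refl = v∈
      ⊆₂ : σ ⊆ σ′ ∪ ⁅ v ⁆
      ⊆₂ {x} x∈ with x Finₚ.≟ v
      ... | yes refl = ∈-∪⁅⁆⁺ʳ v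
      ... | no x≢v = ∈-∪⁅⁆⁺ˡ (Subsetₚ.x∈p∧x≢y⇒x∈p-y x∈ x≢v)
  covered {W} (branch v Wv s t _) {I} sep {σ} cell rewrite elems-++ (matching s I) (matching t (I ∪ ⁅ v ⁆)) with v Subsetₚ.∈? σ
  ... | no v∉ with covered s (separated-del {W = W} sep) (cell-del⁺ sep Wv cell v∉)
  ... | inj₁ p = inj₁ (∈-++⁺ˡ p)
  ... | inj₂ p = inj₂ (∈-++⁺ˡ p)
  covered {W} (branch v Wv s t _) {I} sep {σ} cell | yes v∈ with covered t (separated-link {W = W} sep) (cell-link⁺ sep Wv cell v∈)
  ... | inj₁ p = inj₁ (∈-++⁺ʳ _ p)
  ... | inj₂ p = inj₂ (∈-++⁺ʳ _ p)

  -- At a branch vertex v, membership of v can only be lost along a gradient path, hence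
  -- it is constant on a closed one; at an isolated vertex the lower cells can only shrink.
  closed-path-constant : ∀ {W b} (t : Tree W b) {I} → Separated I W → ∀ ps → All (_∈ matching t I) ps →
    Linked (λ p q → upper G p ⊃ lower G q) (ps ++ take 1 ps) → ∀ {p q} → p ∈ ps → q ∈ ps → p ≡ q
  closed-path-constant (void _ _) sep (_ ∷ _) (() ∷ _)
  closed-path-constant {W} t@(isolated v Wv iso) {I} sep ps ps∈ l {p} {q} p∈ q∈ =
    same (∈-map⁻ (_, v) (All.lookup ps∈ p∈)) (∈-map⁻ (_, v) (All.lookup ps∈ q∈))
      (Subsetₚ.⊆-antisym (shrink q∈ p∈) (shrink p∈ q∈))
    where
    same : ∀ {p q} → (∃ λ σ → σ ∈ _ × p ≡ (σ , v)) → (∃ λ σ → σ ∈ _ × q ≡ (σ , v)) → lower G p ≡ lower G q → p ≡ q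
    same (_ , _ , refl) (_ , _ , refl) refl = refl
    M = matching t I
    ps∈′ : All (_∈ M) (ps ++ take 1 ps)
    ps∈′ = Allₚ.++⁺ ps∈ (Allₚ.take⁺ 1 ps∈)
    step : ∀ {p q} → p ∈ M → q ∈ M → upper G p ⊃ lower G q → lower G q ⊆ lower G p
    step p∈ q∈ (⊆p , _) {x} x∈ with ∈-map⁻ (_, v) p∈ | ∈-map⁻ (_, v) q∈
    ... | σ , _ , refl | τ , _ , refl with ∈-∪⁅⁆⁻ {I = σ} {v = v} (⊆p x∈)
    ... | inj₁ x∈σ = x∈σ
    ... | inj₂ refl = ⊥-elim (proj₁ (proj₂ (matching-cells t sep q∈)) x∈)
    shrink : ∀ {p q} → p ∈ ps → q ∈ ps → lower G q ⊆ lower G p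
    shrink = closed-chain {R = λ p q → lower G q ⊆ lower G p} (λ qp rq → qp ∘ rq) ps
      (All-relink {P = _∈ M} step ps∈′ l)
  closed-path-constant {W} (branch v Wv s t _) {I} sep ps ps∈ l {p} {q} p∈ q∈ = split (v Subsetₚ.∈? lower G p)
    where
    sepₛ = separated-del {W = W} sep
    sepₜ = separated-link {W = W} sep
    M = matching s I ++ matching t (I ∪ ⁅ v ⁆)
    step : ∀ {p q} → p ∈ M → upper G p ⊃ lower G q → v ∈ₛ lower G q → v ∈ₛ lower G p
    step p∈ (⊆p , _) v∈ with ∈-++⁻ (matching s I) p∈
    ... | inj₁ p∈s = ⊥-elim (proj₂ (cell-del⁻ sep Wv (proj₂ (proj₂ (matching-cells s sepₛ p∈s)))) (⊆p v∈))
    ... | inj₂ p∈t = proj₂ (cell-link⁻ sep Wv (proj₁ (matching-cells t sepₜ p∈t)))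
    inherit : ∀ {p q} → p ∈ ps → q ∈ ps → v ∈ₛ lower G q → v ∈ₛ lower G p
    inherit = closed-chain {R = λ p q → v ∈ₛ lower G q → v ∈ₛ lower G p} (λ f g → f ∘ g) ps
      (All-relink {P = _∈ M} (λ {p} {q} p∈ _ → step {p} {q} p∈) (Allₚ.++⁺ ps∈ (Allₚ.take⁺ 1 ps∈)) l)
    in-s : v ∉ₛ lower G p → ∀ {r} → r ∈ ps → r ∈ matching s I
    in-s v∉p r∈ with ∈-++⁻ (matching s I) (All.lookup ps∈ r∈)
    ... | inj₁ r∈s = r∈s
    ... | inj₂ r∈t = ⊥-elim (v∉p (inherit p∈ r∈ (proj₂ (cell-link⁻ sep Wv (proj₁ (matching-cells t sepₜ r∈t))))))
    in-t : v ∈ₛ lower G p → ∀ {r} → r ∈ ps → r ∈ matching t (I ∪ ⁅ v ⁆)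
    in-t v∈p r∈ with ∈-++⁻ (matching s I) (All.lookup ps∈ r∈)
    ... | inj₁ r∈s = ⊥-elim (proj₂ (cell-del⁻ sep Wv (proj₁ (matching-cells s sepₛ r∈s))) (inherit r∈ p∈ v∈p))
    ... | inj₂ r∈t = r∈t
    -- All pairs of the closed path lie in the same branch as `p`, so the induction hypothesis
    -- applies there.
    split : Dec (v ∈ₛ lower G p) → p ≡ q
    split (no v∉p) = closed-path-constant s sepₛ ps (All.tabulate (in-s v∉p)) l p∈ q∈
    split (yes v∈p) = closed-path-constant t sepₜ ps (All.tabulate (in-t v∈p)) l p∈ q∈

  tree⇒cBoundedBy : ∀ {b} → Tree (λ _ → true) b → cBoundedBy G b
  tree⇒cBoundedBy {b} t = M , ((All.tabulate valid , elems-unique t sep) , acyclic) , few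
    where
    sep : Separated ∅ (λ _ → true)
    sep x∈ = ⊥-elim (Subsetₚ.∉⊥ x∈)
    M = matching t ∅
    valid : ∀ {p} → p ∈ M → ValidPair G p
    valid p∈ = let c , v∉ , c′ = matching-cells t sep p∈ in proj₁ c , v∉ , proj₁ c′
    acyclic : ¬ MatchingCycle G M
    acyclic (_ ∷ [] , s≤s () , _)
    acyclic (p ∷ q ∷ ps , _ , (p∉ ∷ _) , ps∈ , l) =
      All.lookup p∉ (here refl) (closed-path-constant t sep (p ∷ q ∷ ps) ps∈ l (here refl) (there (here refl)))
    few : numCritical G M ≤ b
    few = ℕₚ.≤-trans (Unique-⊆⇒length≤ (Uniqueₚ.filter⁺ (critical? G M) (allSubsets-unique G n)) ⊆crit) (length-critical t ∅)
      where
      ⊆crit : ∀ {σ} → σ ∈ filter (critical? G M) (allSubsets G n) → σ ∈ critical t ∅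
      ⊆crit σ∈ with ∈-filter⁻ (critical? G M) {xs = allSubsets G n} σ∈
      ... | _ , ind , σ∉ with covered t sep (ind , Subsetₚ.⊥⊆ , λ _ _ → inj₂ refl)
      ... | inj₁ σ∈M = ⊥-elim (σ∉ σ∈M)
      ... | inj₂ σ∈c = σ∈c

-- Cutting along a path

+-*-≤ : ∀ X a {c b} → a + c ≤ b → a * X + c * X ≤ b * X
+-*-≤ X a a+c≤b = ℕₚ.≤-trans (ℕₚ.≤-reflexive (sym (ℕₚ.*-distribʳ-+ X a _))) (ℕₚ.*-monoˡ-≤ X a+c≤b)

-- What has happened to the vertex preceding a segment: deleted alone, or together with
-- its neighbours, in which case the first vertex of the segment is gone as well.
data Front : Set where
  skipped taken : Front

module Segments {n : ℕ} (hi : Fin n → Bool) where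

  High Low : Fin n → Set
  High x = hi x ≡ true
  Low x = hi x ≡ false

  highs : List (Fin n) → ℕ
  highs [] = 0
  highs (x ∷ P) = (if hi x then 1 else 0) + highs P

  -- A surviving low vertex x whose predecessor is gone is a leaf, so the vertex after x can be
  -- taken without branching; this is what the match rules record. Cancels f P: processing the
  -- low run P in this way ends in an isolated vertex. Gains f P: it removes the first high
  -- vertex of P, or P has none.
  data Cancels : Front → List (Fin n) → Set where
    single : ∀ {x} → Low x → Cancels skipped (x ∷ [])
    shift : ∀ {x P} → Cancels skipped P → Cancels taken (x ∷ P)
    match : ∀ {x y P} → Low x → Cancels taken P → Cancels skipped (x ∷ y ∷ P)

  data Gains : Front → List (Fin n) → Set where
    none : ∀ {f P} → highs P ≡ 0 → Gains f P
    hit : ∀ {x P} → High x → Gains taken (x ∷ P)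
    shift : ∀ {x P} → Low x → Gains skipped P → Gains taken (x ∷ P)
    match-high : ∀ {x y P} → Low x → High y → Gains skipped (x ∷ y ∷ P)
    match-low : ∀ {x y P} → Low x → Low y → Gains taken P → Gains skipped (x ∷ y ∷ P)

  count-low : ∀ {x P} → Low x → highs (x ∷ P) ≡ highs P
  count-low l rewrite l = refl

  count-high : ∀ {x P} → High x → highs (x ∷ P) ≡ suc (highs P)
  count-high h rewrite h = refl

  -- The pattern repeats after three low vertices.
  gains : ∀ P → ∃ λ f → Gains f P
  gains [] = taken , none refl
  gains (x ∷ P) with hi x in hx
  gains (x ∷ P) | true = taken , hit hx
  gains (x ∷ []) | false = taken , none (count-low {P = []} hx)
  gains (x ∷ y ∷ P) | false with hi y in hy
  ... | true = skipped , match-high hx hy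
  gains (x ∷ y ∷ []) | false | false = taken , none (trans (count-low {P = y ∷ []} hx) (count-low {P = []} hy))
  gains (x ∷ y ∷ z ∷ P) | false | false with hi z in hz
  ... | true = skipped , match-low hx hy (hit hz)
  ... | false with gains P
  ... | taken , g = taken , shift hx (match-low hy hz g)
  ... | skipped , g = skipped , match-low hx hy (shift hz g)

  highs-prefix : ∀ P {R} → highs (P ++ R) ≡ 0 → highs P ≡ 0
  highs-prefix [] _ = refl
  highs-prefix (x ∷ P) c with hi x
  ... | false = highs-prefix P c

  -- If truncation drops the gained vertex, no high vertex is left and `none` applies. This lets the
  -- two paths at `s`, one a prefix of the other, share one pattern.
  gains-prefix : ∀ {f} P {R} → Gains f (P ++ R) → Gains f P
  gains-prefix [] _ = none refl
  gains-prefix (x ∷ []) {R} (none c) = none (highs-prefix (x ∷ []) {R} c)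
  gains-prefix (x ∷ []) (hit h) = hit h
  gains-prefix (x ∷ []) (shift l g) = shift l (none refl)
  gains-prefix (x ∷ []) (match-high l h) = none (count-low {P = []} l)
  gains-prefix (x ∷ []) (match-low l _ _) = none (count-low {P = []} l)
  gains-prefix (x ∷ y ∷ P) {R} (none c) = none (highs-prefix (x ∷ y ∷ P) {R} c)
  gains-prefix (x ∷ y ∷ P) (hit h) = hit h
  gains-prefix (x ∷ y ∷ P) (shift l g) = shift l (gains-prefix (y ∷ P) g)
  gains-prefix (x ∷ y ∷ P) (match-high l h) = match-high l h
  gains-prefix (x ∷ y ∷ P) (match-low l l′ g) = match-low l l′ (gains-prefix P g)

  -- loose h bounds the number of leaves for a segment with h high vertices, and tight h
  -- the number when moreover the first high vertex is removed for free.
  record Mode : Set₁ where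
    field
      tight loose : ℕ → ℕ
      -- A condition on the far end of the segment. Segments are consumed from the front, so it has
      -- to pass to tails.
      Ends : List (Fin n) → Set
      ends-tail : ∀ {x P} → Ends (x ∷ P) → Ends P
      1≤loose : 1 ≤ loose 0
      start : loose 0 ≤ tight 0
      loose-mono : ∀ h → loose h ≤ loose (suc h)
      loose≤tight : ∀ h → loose h ≤ tight (suc h)
      -- Branching at `x` is paid for by a Fibonacci step, one branch loose and the other tight, or
      -- by one branch costing nothing.
      split : ∀ {x P} → High x → Ends (x ∷ P) →
        loose (highs P) + tight (highs P) ≤ loose (suc (highs P)) ⊎ ∃ λ f → Cancels f P

  module Routes (G : Graph n) (W : Fin n → Bool) where

    next : List (Fin n) → Fin n → Fin n
    next [] t = t
    next (x ∷ _) _ = x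

    -- The vertices `o` and `t` flank the list. Chords are excluded only where a low vertex is
    -- involved: two high vertices may be adjacent at any distance.
    data Route (o : Fin n) : List (Fin n) → Fin n → Set where
      [] : ∀ {t} → Route o [] t
      cons : ∀ {x P t} → (Low x → ∀ {y} → W ∋ y → adj G x y ≡ true → y ≡ o ⊎ y ≡ next P t) →
        x ∉ P → (∀ {y} → y ∈ take 1 P → adj G x y ≡ true) →
        (∀ {y} → y ∈ drop 1 P → Low y → ¬ adj G x y ≡ true) →
        Route x P t → Route o (x ∷ P) t

  -- `X` bounds the cost of whatever is left once all of `C` is gone; grafting such trees onto the
  -- leaves of the cutting multiplies its cost by `X`.
  module Cutting (G : Graph n) (W : Fin n → Bool) (C : List (Fin n)) (X : ℕ)
    (rest : ∀ V → V ⊆ᵇ W → (∀ {c} → c ∈ C → ¬ V ∋ c) → Tree G V X) where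

    open Routes G W

    -- The vertices of C surviving in V lie on the segment P between the removed vertices o and t.
    record State (V : Fin n → Bool) (o : Fin n) (P : List (Fin n)) (t : Fin n) : Set where
      constructor state
      field
        sub : V ⊆ᵇ W
        dead-o : ¬ V ∋ o
        dead-t : ¬ V ∋ t
        cover : ∀ {c} → c ∈ C → V ∋ c → c ∈ P
        -- The fate of the first vertex is left to `AtFront`, and high vertices may have been lost
        -- through chords.
        alive : ∀ {x} → x ∈ drop 1 P → Low x → V ∋ x

    AtFront : Front → (Fin n → Bool) → List (Fin n) → Set
    AtFront skipped V P = ∀ {x} → x ∈ take 1 P → Low x → V ∋ x
    AtFront taken V P = ∀ {x} → x ∈ take 1 P → ¬ V ∋ x

    ∈-drop₁ : ∀ {P} {x : Fin n} → x ∈ drop 1 P → x ∈ P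
    ∈-drop₁ {_ ∷ _} = there

    ∈-take₁ : ∀ {P} {x : Fin n} → x ∈ take 1 P → x ∈ P
    ∈-take₁ {_ ∷ _} (here e) = here e

    ∈-uncons : ∀ {P} {x y : Fin n} → y ∈ x ∷ P → y ≢ x → y ∈ P
    ∈-uncons (here e) ne = ⊥-elim (ne e)
    ∈-uncons (there y∈) _ = y∈

    pass : ∀ {V o x P t} → State V o (x ∷ P) t → ¬ V ∋ x → State V x P t × AtFront skipped V P
    pass (state sub d₀ d₁ cov al) dx =
      state sub dx d₁ (λ c∈ Vc → ∈-uncons (cov c∈ Vc) λ { refl → dx Vc }) (al ∘ ∈-drop₁) , al ∘ ∈-take₁

    skip : ∀ {V o x P t} → Route o (x ∷ P) t → State V o (x ∷ P) t →
      State (del x V) x P t × AtFront skipped (del x V) P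
    skip {V} {x = x} {P} (cons _ x∉P _ _ _) (state sub d₀ d₁ cov al) = state
      (λ p → sub (proj₁ (del⁻ {W = V} p))) (λ p → proj₂ (del⁻ {W = V} p) refl) (λ p → d₁ (proj₁ (del⁻ {W = V} p)))
      (λ c∈ p → ∈-uncons (cov c∈ (proj₁ (del⁻ {W = V} p))) (proj₂ (del⁻ {W = V} p)))
      (still ∘ ∈-drop₁) , (still ∘ ∈-take₁)
      where
      still : ∀ {y} → y ∈ P → Low y → del x V ∋ y
      still y∈ ly = del⁺ {W = V} (al y∈ ly) λ { refl → x∉P y∈ }

    -- The facts are listed singly instead of as a `State`: in `match-step` the predecessor of the
    -- picked vertex is still present and disappears only with the pick.
    pick : ∀ {V o x P t} → V ⊆ᵇ W → ¬ V ∋ t → (∀ {c} → c ∈ C → link G x V ∋ c → c ∈ x ∷ P) →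
      (∀ {y} → y ∈ drop 1 P → Low y → V ∋ y) → Route o (x ∷ P) t →
      State (link G x V) x P t × AtFront taken (link G x V) P
    pick {V} {x = x} {P} sub d₁ cov al (cons _ x∉P x~ x≁ _) = state
      (λ p → sub (proj₁ (link⁻ G {W = V} p))) (λ p → proj₁ (proj₂ (link⁻ G {W = V} p)) refl)
      (λ p → d₁ (proj₁ (link⁻ G {W = V} p)))
      (λ c∈ p → ∈-uncons (cov c∈ p) (proj₁ (proj₂ (link⁻ G {W = V} p))))
      (λ y∈ ly → link⁺ G {W = V} (al y∈ ly) (λ { refl → x∉P (∈-drop₁ y∈) }) (x≁ y∈ ly))
      , λ y∈ p → proj₂ (proj₂ (link⁻ G {W = V} p)) (x~ y∈)

    -- As `o` is gone, `y` is the only neighbour the low vertex `x` can have. If `y` is gone too,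
    -- `x` is isolated and everything costs 0; otherwise the leaf rule takes `y`, which removes the
    -- first vertex of `P`.
    match-step : ∀ {V o x y P t b} → Low x → Route o (x ∷ y ∷ P) t → State V o (x ∷ y ∷ P) t → V ∋ x →
      (∀ {V′} → State V′ y P t → AtFront taken V′ P → Tree G V′ b) → Tree G V b
    match-step {V} {o} {x} {y} {P} lx (cons nbr x∉ x~ _ r) (state sub d₀ d₁ cov al) Vx k with V ∋? y
    ... | no dy = isolated x Vx λ Vz xz → case nbr lx (sub Vz) xz of λ where
            (inj₁ refl) → d₀ Vz
            (inj₂ refl) → dy Vz
    ... | yes Vy = leaf G Vx Vy (x~ (here refl)) only (k (proj₁ st) (proj₂ st))
      where
      only : ∀ {z} → V ∋ z → adj G x z ≡ true → z ≡ y
      only Vz xz with nbr lx (sub Vz) xz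
      ... | inj₁ refl = ⊥-elim (d₀ Vz)
      ... | inj₂ e = e
      st = pick sub d₁
        (λ c∈ p → ∈-uncons (cov c∈ (proj₁ (link⁻ G {W = V} p)))
          λ { refl → proj₂ (proj₂ (link⁻ G {W = V} p)) (adj-true-sym G (x~ (here refl))) })
        (λ z∈ → al (there (∈-drop₁ z∈))) r

    lone : ∀ {V o x t b} → Low x → Route o (x ∷ []) t → State V o (x ∷ []) t → V ∋ x → Tree G V b
    lone {x = x} lx (cons nbr _ _ _ _) s Vx = isolated x Vx λ Vz xz → case nbr lx (State.sub s Vz) xz of λ where
      (inj₁ refl) → State.dead-o s Vz
      (inj₂ refl) → State.dead-t s Vz

    route-tail : ∀ {o x P t} → Route o (x ∷ P) t → Route x P t
    route-tail (cons _ _ _ _ r) = r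

    cancel : ∀ {V o P t f} → Cancels f P → Route o P t → State V o P t → AtFront f V P → Tree G V 0
    cancel (single lx) r s u = lone lx r s (u (here refl) lx)
    cancel (shift c) r s u = let s′ , u′ = pass s (u (here refl)) in cancel c (route-tail r) s′ u′
    cancel (match lx c) r s u = match-step lx r s (u (here refl) lx)
      λ s′ u′ → cancel c (route-tail (route-tail r)) s′ u′

    module _ (mode : Mode) where
      open Mode mode

      weaken-* : ∀ {V a b} → a ≤ b → Tree G V (a * X) → Tree G V (b * X)
      weaken-* a≤b = weaken G (ℕₚ.*-monoˡ-≤ X a≤b)

      -- The predecessor of the front vertex is gone, so the leaf rule handles a low one; only a
      -- surviving high vertex forces a branching.
      loose-cut : ∀ {V o t} P → Ends P → Route o P t → State V o P t → Tree G V (loose (highs P) * X)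
      tight-cut : ∀ {V o t f} P → Gains f P → Ends P → Route o P t → State V o P t → AtFront f V P →
        Tree G V (tight (highs P) * X)

      loose-cut [] e r s = weaken G (ℕₚ.≤-trans (ℕₚ.≤-reflexive (sym (ℕₚ.*-identityˡ X))) (ℕₚ.*-monoˡ-≤ X 1≤loose))
        (rest _ (State.sub s) λ c∈ Vc → case State.cover s c∈ Vc of λ ())
      loose-cut {V} (x ∷ P) e r s with V ∋? x | hi x in hx
      ... | no dx | false = loose-cut P (ends-tail e) (route-tail r) (proj₁ (pass s dx))
      -- Already removed along with an earlier vertex, so one branching is saved.
      ... | no dx | true = weaken-* (loose-mono _) (loose-cut P (ends-tail e) (route-tail r) (proj₁ (pass s dx)))
      loose-cut (x ∷ []) e r s | yes Vx | false = lone hx r s Vx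
      -- The leaf rule disposes of `y` without a branching even if `y` is high.
      loose-cut (x ∷ y ∷ P) e r s | yes Vx | false = weaken-* (count-tail y P)
          (match-step hx r s Vx λ s′ _ → loose-cut P (ends-tail (ends-tail e)) (route-tail (route-tail r)) s′)
        where
        count-tail : ∀ y P → loose (highs P) ≤ loose (highs (y ∷ P))
        count-tail y P with hi y
        ... | true = loose-mono _
        ... | false = ℕₚ.≤-refl
      loose-cut {V} (x ∷ P) e r s | yes Vx | true = join (split hx e)
        where
        r′ = route-tail r
        e′ = ends-tail e
        s₀ = skip r s
        s₁ = pick (State.sub s) (State.dead-t s) (λ c∈ p → State.cover s c∈ (proj₁ (link⁻ G {W = V} p)))
               (State.alive s ∘ ∈-drop₁) r
        h = highs P
        loose-skipped : Tree G (del x V) (loose h * X)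
        loose-skipped = loose-cut P e′ r′ (proj₁ s₀)
        loose-taken : Tree G (link G x V) (loose h * X)
        loose-taken = loose-cut P e′ r′ (proj₁ s₁)
        join : loose h + tight h ≤ loose (suc h) ⊎ (∃ λ f → Cancels f P) → Tree G V (loose (suc h) * X)
        -- The branch named by `gains` gets the tight bound, the other one the loose bound.
        join (inj₁ ≤l) with gains P
        ... | skipped , g = branch x Vx (tight-cut P g e′ r′ (proj₁ s₀) (proj₂ s₀)) loose-taken
                (+-*-≤ X (tight h) (ℕₚ.≤-trans (ℕₚ.≤-reflexive (ℕₚ.+-comm (tight h) _)) ≤l))
        ... | taken , g = branch x Vx loose-skipped (tight-cut P g e′ r′ (proj₁ s₁) (proj₂ s₁)) (+-*-≤ X (loose h) ≤l)
        join (inj₂ (skipped , c)) = branch x Vx (cancel c r′ (proj₁ s₀) (proj₂ s₀)) loose-taken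
          (ℕₚ.*-monoˡ-≤ X (loose-mono h))
        join (inj₂ (taken , c)) = branch x Vx loose-skipped (cancel c r′ (proj₁ s₁) (proj₂ s₁))
          (ℕₚ.≤-trans (ℕₚ.≤-reflexive (ℕₚ.+-identityʳ _)) (ℕₚ.*-monoˡ-≤ X (loose-mono h)))

      tight-cut {V} P (none c) e r s u = subst (λ h → Tree G V (tight h * X)) (sym c)
        (weaken-* start (subst (λ h → Tree G V (loose h * X)) c (loose-cut P e r s)))
      tight-cut {V} (x ∷ P) (hit hx) e r s u = subst (λ h → Tree G V (tight h * X)) (sym (count-high {P = P} hx))
        (weaken-* (loose≤tight _) (loose-cut P (ends-tail e) (route-tail r) (proj₁ (pass s (u (here refl))))))
      tight-cut {V} (x ∷ P) (shift lx g) e r s u = subst (λ h → Tree G V (tight h * X)) (sym (count-low {P = P} lx))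
        (let s′ , u′ = pass s (u (here refl)) in tight-cut P g (ends-tail e) (route-tail r) s′ u′)
      tight-cut {V} (x ∷ y ∷ P) (match-high lx hy) e r s u =
        subst (λ h → Tree G V (tight h * X)) (sym (trans (count-low {P = y ∷ P} lx) (count-high {P = P} hy)))
        (weaken-* (loose≤tight _) (match-step lx r s (u (here refl) lx)
          λ s′ _ → loose-cut P (ends-tail (ends-tail e)) (route-tail (route-tail r)) s′))
      tight-cut {V} (x ∷ y ∷ P) (match-low lx ly g) e r s u =
        subst (λ h → Tree G V (tight h * X)) (sym (trans (count-low {P = y ∷ P} lx) (count-low {P = P} ly)))
        (match-step lx r s (u (here refl) lx)
          λ s′ u′ → tight-cut P g (ends-tail (ends-tail e)) (route-tail (route-tail r)) s′ u′)

-- Cutting along a cycle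

fib-mono : ∀ n → fib n ≤ fib (suc n)
fib-mono zero = z≤n
fib-mono (suc n) = ℕₚ.m≤m+n _ _

-- With e = n + 2, the balanced cost 2φ(e) at `s` is dominated by the unbalanced one, φ(e - 1) + φ(e
-- + 1); the difference is φ(e - 1) - φ(e - 2).
2fib≤lucas : ∀ n → fib (suc (suc n)) + fib (suc (suc n)) ≤ lucas (suc (suc n))
2fib≤lucas n = ℕₚ.≤-trans
  (ℕₚ.+-monoˡ-≤ (fib (2 + n)) (ℕₚ.+-monoʳ-≤ (fib (1 + n)) (fib-mono n)))
  (ℕₚ.≤-reflexive (trans (ℕₚ.+-assoc (fib (1 + n)) _ _) (cong (fib (1 + n) +_) (ℕₚ.+-comm (fib (1 + n)) _))))

module CycleCut {n : ℕ} (hi : Fin n → Bool) where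
  open Segments hi

  last-high : ∀ P → highs P ≡ 0 ⊎ ∃ λ P₀ → ∃ λ z → ∃ λ B → P ≡ P₀ ++ z ∷ B × High z × highs B ≡ 0
  last-high [] = inj₁ refl
  last-high (x ∷ P) with last-high P | hi x in hx
  ... | inj₂ (P₀ , z , B , refl , hz , lB) | _ = inj₂ (x ∷ P₀ , z , B , refl , hz , lB)
  ... | inj₁ lP | true = inj₂ ([] , x , P , refl , hx , lP)
  ... | inj₁ lP | false = inj₁ lP

  highs-++ : ∀ P {R} → highs (P ++ R) ≡ highs P + highs R
  highs-++ [] = refl
  highs-++ (x ∷ P) {R} rewrite highs-++ P {R} = sym (ℕₚ.+-assoc _ (highs P) (highs R))

  after-high : ∀ P₀ {z B} → High z → highs (P₀ ++ z ∷ B) ≢ 0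
  after-high P₀ {z} {B} hz c rewrite highs-++ P₀ {z ∷ B} | hz with trans (sym (ℕₚ.+-suc (highs P₀) (highs B))) c
  ... | ()

  last-high-unique : ∀ P₀ A {z x B B′} → P₀ ++ z ∷ B ≡ A ++ x ∷ B′ → High z → High x →
    highs B ≡ 0 → highs B′ ≡ 0 → B ≡ B′
  last-high-unique [] [] refl _ _ _ _ = refl
  last-high-unique [] (_ ∷ A) refl _ hx lB _ = ⊥-elim (after-high A hx lB)
  last-high-unique (_ ∷ P₀) [] refl hz _ _ lB′ = ⊥-elim (after-high P₀ hz lB′)
  last-high-unique (_ ∷ P₀) (_ ∷ A) e = last-high-unique P₀ A (Listₚ.∷-injectiveʳ e)

  -- One use of the leaf rule removes three consecutive vertices: the leaf, the vertex taken and the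
  -- one after it.
  cancels-period : ∀ {f x y z B} → Low x → Low y → Cancels f B → Cancels f (x ∷ y ∷ z ∷ B)
  cancels-period {skipped} lx ly k = match lx (shift k)
  cancels-period {taken} lx ly k = shift (match ly k)

  -- A run of l low vertices cancels from one side unless 3 divides l.
  cancels : ∀ B → highs B ≡ 0 → B ≡ [] ⊎ (∃ λ f → Cancels f B) ⊎
    ∃ λ B′ → ∃ λ x → B ≡ B′ ++ x ∷ [] × ∃ λ f → Cancels f B′
  cancels [] _ = inj₁ refl
  cancels (x ∷ B) c with hi x in hx
  cancels (x ∷ []) c | false = inj₂ (inj₁ (skipped , single hx))
  cancels (x ∷ y ∷ B) c | false with hi y in hy
  cancels (x ∷ y ∷ []) c | false | false = inj₂ (inj₁ (taken , shift (single hy)))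
  cancels (x ∷ y ∷ z ∷ B) c | false | false with hi z in hz
  ... | false with cancels B c
  ... | inj₁ refl = inj₂ (inj₂ (x ∷ y ∷ [] , z , refl , taken , shift (single hy)))
  ... | inj₂ (inj₁ (f , k)) = inj₂ (inj₁ (f , cancels-period hx hy k))
  ... | inj₂ (inj₂ (B′ , w , refl , f , k)) = inj₂ (inj₂ (x ∷ y ∷ z ∷ B′ , w , refl , f , cancels-period hx hy k))

  -- Here `split` is the Fibonacci recursion, and `loose≤tight` is an equality.
  plain : Mode
  plain = record
    { tight = λ h → fib (1 + h) ; loose = λ h → fib (2 + h) ; Ends = λ _ → ⊤ ; ends-tail = _
    ; 1≤loose = ℕₚ.≤-refl ; start = ℕₚ.≤-refl ; loose-mono = λ h → fib-mono (2 + h)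
    ; loose≤tight = λ _ → ℕₚ.≤-refl ; split = λ _ _ → inj₁ ℕₚ.≤-refl }

  -- Quantifying over all decompositions makes the condition pass to tails and become vacuous once
  -- the last high vertex has been consumed.
  CancellingEnd : List (Fin n) → Set
  CancellingEnd P = ∀ A x B → P ≡ A ++ x ∷ B → High x → highs B ≡ 0 → ∃ λ f → Cancels f B

  -- At the last high vertex of P one of the two branches dies, so this vertex costs nothing.
  cancelling : Mode
  cancelling = record
    -- The truncated subtraction gives 0 and 1 high vertices the same bounds, as the last one is
    -- free.
    { tight = λ h → fib (1 + (h ∸ 1)) ; loose = λ h → fib (2 + (h ∸ 1)) ; Ends = CancellingEnd
    ; ends-tail = λ {x} e A z B p → e (x ∷ A) z B (cong (x ∷_) p)
    ; 1≤loose = ℕₚ.≤-refl ; start = ℕₚ.≤-refl ; loose-mono = mono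
    ; loose≤tight = λ { zero → ℕₚ.≤-refl ; (suc h) → ℕₚ.≤-refl } ; split = split }
    where
    mono : ∀ h → fib (2 + (h ∸ 1)) ≤ fib (2 + (suc h ∸ 1))
    mono zero = ℕₚ.≤-refl
    mono (suc h) = fib-mono (2 + h)
    split : ∀ {x P} → High x → CancellingEnd (x ∷ P) →
      fib (2 + (highs P ∸ 1)) + fib (1 + (highs P ∸ 1)) ≤ fib (2 + (suc (highs P) ∸ 1)) ⊎ ∃ λ f → Cancels f P
    split {x} {P} hx e with highs P in c
    ... | zero = inj₂ (e [] x P refl hx c)
    ... | suc h = inj₁ ℕₚ.≤-refl

  cancelling-end : ∀ P₀ {z B f} → High z → highs B ≡ 0 → Cancels f B → CancellingEnd (P₀ ++ z ∷ B)
  cancelling-end P₀ hz lB k A x B′ e hx lB′ with last-high-unique P₀ A e hz hx lB lB′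
  ... | refl = _ , k

  -- The cycle is `s`, `Q`, `t`. Deleting `s` leaves the path `P`; taking `s` removes `t` and leaves
  -- `Q`, whose first vertex is gone as well.
  module _ (G : Graph n) (W : Fin n → Bool) (X : ℕ) (s t : Fin n) (Q : List (Fin n)) where

    private P = Q ++ t ∷ []

    module _ (rest : ∀ V → V ⊆ᵇ W → (∀ {c} → c ∈ s ∷ P → ¬ V ∋ c) → Tree G V X) where
      open Routes G W
      open Cutting G W (s ∷ P) X rest
      module _
        (Ws : W ∋ s) (WP : ∀ {x} → x ∈ P → W ∋ x) (s∉P : s ∉ P) (st : adj G s t ≡ true)
        (s~ : ∀ {x} → x ∈ take 1 Q → adj G s x ≡ true)
        (s≁ : ∀ {x} → x ∈ drop 1 Q → Low x → ¬ adj G s x ≡ true)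
        (route : Route s P s) where

        route-init : ∀ {o t u} R → Route o (R ++ t ∷ []) u → Route o R t
        route-init [] _ = []
        route-init (x ∷ []) (cons nbr x∉ _ _ r) = cons nbr (λ ()) (λ ()) (λ ()) []
        route-init (x ∷ y ∷ R) (cons nbr x∉ x~ x≁ r) =
          cons nbr (x∉ ∘ ∈-++⁺ˡ) x~′ (λ y∈ → x≁ (∈-++⁺ˡ y∈)) (route-init (y ∷ R) r)
          where
          x~′ : ∀ {z} → z ∈ y ∷ [] → adj G x z ≡ true
          x~′ (here e) = x~ (here e)

        state-skip : State (del s W) s P s × AtFront skipped (del s W) P
        state-skip = state (λ p → proj₁ (del⁻ {W = W} p)) gone gone
          (λ c∈ p → ∈-uncons c∈ (proj₂ (del⁻ {W = W} p))) (λ x∈ _ → still (∈-drop₁ x∈)) , λ x∈ _ → still (∈-take₁ x∈)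
          where
          gone : ¬ del s W ∋ s
          gone p = proj₂ (del⁻ {W = W} p) refl
          still : ∀ {x} → x ∈ P → del s W ∋ x
          still x∈ = del⁺ {W = W} (WP x∈) λ { refl → s∉P x∈ }

        state-take : State (link G s W) s Q t × AtFront taken (link G s W) Q
        state-take = state (λ p → proj₁ (link⁻ G {W = W} p)) (λ p → proj₁ (proj₂ (link⁻ G {W = W} p)) refl)
          (λ p → proj₂ (proj₂ (link⁻ G {W = W} p)) st) cover
          (λ x∈ lx → link⁺ G {W = W} (WP (∈-++⁺ˡ (∈-drop₁ {Q} x∈))) (λ { refl → s∉P (∈-++⁺ˡ (∈-drop₁ {Q} x∈)) }) (s≁ x∈ lx))
          , λ x∈ p → proj₂ (proj₂ (link⁻ G {W = W} p)) (s~ x∈)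
          where
          cover : ∀ {c} → c ∈ s ∷ P → link G s W ∋ c → c ∈ Q
          cover c∈ p with ∈-++⁻ Q (∈-uncons c∈ (proj₁ (proj₂ (link⁻ G {W = W} p))))
          ... | inj₁ c∈Q = c∈Q
          ... | inj₂ (here refl) = ⊥-elim (proj₂ (proj₂ (link⁻ G {W = W} p)) st)

        -- Which branch is the tight one depends on the low vertices after `s`, so both sums have to
        -- stay below `b`. The modes are independent because the saving at the far end occurs in
        -- only one of the paths.
        join : (μ ν : Mode) → Mode.Ends μ Q → Mode.Ends ν P → ∀ b →
          Mode.loose μ (highs Q) + Mode.tight ν (highs P) ≤ b →
          Mode.tight μ (highs Q) + Mode.loose ν (highs P) ≤ b → Tree G W (b * X)
        join μ ν eQ eP b skipped≤ taken≤ with gains P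
        ... | skipped , g = branch s Ws (tight-cut ν P g eP route (proj₁ state-skip) (proj₂ state-skip))
                (loose-cut μ Q eQ (route-init Q route) (proj₁ state-take))
                (+-*-≤ X (Mode.tight ν (highs P)) (ℕₚ.≤-trans (ℕₚ.≤-reflexive (ℕₚ.+-comm _ (Mode.loose μ (highs Q)))) skipped≤))
        ... | taken , g = branch s Ws (loose-cut ν P eP route (proj₁ state-skip))
                (tight-cut μ Q (gains-prefix Q g) eQ (route-init Q route) (proj₁ state-take) (proj₂ state-take))
                (+-*-≤ X (Mode.loose ν (highs P)) (ℕₚ.≤-trans (ℕₚ.≤-reflexive (ℕₚ.+-comm _ (Mode.tight μ (highs Q)))) taken≤))

        highs-P : highs P ≡ highs Q + highs (t ∷ [])
        highs-P = highs-++ Q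

        cut-without-high : highs P ≡ 0 → Tree G W (2 * X)
        cut-without-high c = join plain plain _ _ 2
          (ℕₚ.≤-reflexive (cong₂ (λ a b → fib (2 + a) + fib (1 + b)) cQ c))
          (ℕₚ.≤-reflexive (cong₂ (λ a b → fib (1 + a) + fib (2 + b)) cQ c))
          where
          cQ : highs Q ≡ 0
          cQ = ℕₚ.m+n≡0⇒m≡0 (highs Q) (trans (sym highs-P) c)

        cut-with-high : ∀ {h} → highs P ≡ suc h → Tree G W (lucas (2 + h) * X)
        cut-with-high {h} c with last-high P
        ... | inj₁ c₀ = case trans (sym c) c₀ of λ ()
        ... | inj₂ (P₀ , z , B , eq , hz , lB) = by-end (cancels B lB)
          where
          ℓ = lucas (2 + h)

          at : ∀ {q} (F : ℕ → ℕ → ℕ) → highs Q ≡ q → F q (suc h) ≤ ℓ → F (highs Q) (highs P) ≤ ℓ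
          at F refl ≤ℓ rewrite c = ≤ℓ

          -- Here `t` is the last high vertex, so `Q` has one high vertex less than `P`.
          high-end : Q ≡ P₀ × t ≡ z → Tree G W (ℓ * X)
          high-end (_ , refl) = join plain plain _ _ ℓ
            (at (λ a b → fib (2 + a) + fib (1 + b)) cQ (2fib≤lucas h))
            (at (λ a b → fib (1 + a) + fib (2 + b)) cQ ℕₚ.≤-refl)
            where
            cQ : highs Q ≡ h
            cQ = ℕₚ.suc-injective (trans (sym (trans highs-P
              (trans (cong (highs Q +_) (count-high {P = []} hz)) (ℕₚ.+-comm _ 1)))) c)

          low-end : ∀ {B′ x} → B ≡ B′ ++ x ∷ [] → Q ≡ P₀ ++ z ∷ B′ × highs Q ≡ suc h
          low-end {B′} {x} refl with Listₚ.∷ʳ-injective Q (P₀ ++ z ∷ B′) (trans eq (sym (Listₚ.++-assoc P₀ _ _)))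
          ... | eQ , refl = eQ , trans (sym (ℕₚ.+-identityʳ _)) (trans (cong (highs Q +_)
                  (sym (ℕₚ.m+n≡0⇒n≡0 (highs B′) (trans (sym (highs-++ B′)) lB)))) (trans (sym highs-P) c))

          last-low : ∀ {f} B → Cancels f B → ∃ λ B′ → ∃ λ x → B ≡ B′ ++ x ∷ []
          last-low B k with initLast B
          last-low .[] () | []
          ... | B′ ∷ʳ′ x = B′ , x , refl

          by-end : B ≡ [] ⊎ (∃ λ f → Cancels f B) ⊎ (∃ λ B′ → ∃ λ x → B ≡ B′ ++ x ∷ [] × ∃ λ f → Cancels f B′) →
            Tree G W (ℓ * X)
          by-end (inj₁ refl) = high-end (Listₚ.∷ʳ-injective Q P₀ eq)
          -- The run `B` cancels, so the last high vertex is free in `P`.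
          by-end (inj₂ (inj₁ (_ , k))) =
            join plain cancelling _ (subst CancellingEnd (sym eq) (cancelling-end P₀ hz lB k)) ℓ
              (at (λ a b → fib (2 + a) + fib (1 + (b ∸ 1))) cQ (ℕₚ.≤-reflexive (ℕₚ.+-comm (fib (3 + h)) _)))
              (at (λ a b → fib (1 + a) + fib (2 + (b ∸ 1))) cQ (2fib≤lucas h))
            where cQ = let _ , _ , e = last-low B k in proj₂ (low-end e)
          -- 3 divides the length of `B`, but the run left in `Q` is one shorter and cancels, so the
          -- last high vertex is free in `Q`.
          by-end (inj₂ (inj₂ (B′ , x , e , _ , k))) =
            join cancelling plain (subst CancellingEnd (sym (proj₁ (low-end e)))
                (cancelling-end P₀ hz (highs-prefix B′ (subst (λ B → highs B ≡ 0) e lB)) k)) _ ℓ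
              (at (λ a b → fib (2 + (a ∸ 1)) + fib (1 + b)) cQ (2fib≤lucas h))
              (at (λ a b → fib (1 + (a ∸ 1)) + fib (2 + b)) cQ ℕₚ.≤-refl)
            where cQ = proj₂ (low-end e)

-- Cycles of a graph and its effective girth

module _ {A : Set} {R : A → A → Set} where

  Linked-++⁻ˡ : ∀ xs {ys} → Linked R (xs ++ ys) → Linked R xs
  Linked-++⁻ˡ [] _ = []
  Linked-++⁻ˡ (x ∷ []) _ = [-]
  Linked-++⁻ˡ (x ∷ y ∷ xs) (r ∷ l) = r ∷ Linked-++⁻ˡ (y ∷ xs) l

  Linked-snoc : ∀ xs {x y} → Linked R (xs ++ x ∷ []) → R x y → Linked R ((xs ++ x ∷ []) ++ y ∷ [])
  Linked-snoc [] _ r = r ∷ [-]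
  Linked-snoc (z ∷ []) (r₀ ∷ _) r = r₀ ∷ r ∷ [-]
  Linked-snoc (z ∷ w ∷ xs) (r₀ ∷ l) r = r₀ ∷ Linked-snoc (w ∷ xs) l r

module _ {A : Set} where

  Unique-++⁻ˡ : ∀ (xs : List A) {ys} → Unique (xs ++ ys) → Unique xs
  Unique-++⁻ˡ [] _ = []
  Unique-++⁻ˡ (x ∷ xs) (x∉ ∷ u) = Allₚ.++⁻ˡ xs x∉ ∷ Unique-++⁻ˡ xs u

Unique⇒length≤ : ∀ {n} {xs : List (Fin n)} → Unique xs → length xs ≤ n
Unique⇒length≤ {n} u = ℕₚ.≤-trans (Unique-⊆⇒length≤ u λ {x} _ → ∈-allFin x) (ℕₚ.≤-reflexive (Listₚ.length-tabulate _))

any-list? : ∀ {n} l {P : List (Fin n) → Set} → (∀ xs → Dec (P xs)) → Dec (∃ λ xs → length xs ≡ l × P xs)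
any-list? zero P? = map′ (λ p → [] , refl , p) (λ { ([] , refl , p) → p }) (P? [])
any-list? (suc l) P? = map′ (λ { (x , xs , e , p) → x ∷ xs , cong suc e , p })
  (λ { (x ∷ xs , refl , p) → x , xs , refl , p }) (Finₚ.any? λ x → any-list? l λ xs → P? (x ∷ xs))

module _ {n : ℕ} (G : Graph n) where

  infix 4 _~_
  _~_ : Fin n → Fin n → Set
  u ~ v = T (adj G u v)

  ~-sym : ∀ {u v} → u ~ v → v ~ u
  ~-sym {u} {v} = subst T (adj-sym G u v)

  ~⇒≢ : ∀ {u v} → u ~ v → u ≢ v
  ~⇒≢ uv = adj⇒≢ G (T⇒≡true uv)

  isCycle? : ∀ vs → Dec (IsCycle G vs)
  isCycle? vs = (3 ≤? length vs) ×-dec DecUnique.unique? Finₚ._≟_ vs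
    ×-dec Linked.linked? (λ u v → Boolₚ.T? (adj G u v)) (vs ++ take 1 vs)

  other-neighbour : ∀ {v} → 2 ≤ degree G v → ∀ u → ∃ λ w → v ~ w × w ≢ u
  other-neighbour {v} 2≤ u with filter (λ w → Boolₚ.T? (adj G v w)) (allFin n)
                      | Uniqueₚ.filter⁺ (λ w → Boolₚ.T? (adj G v w)) (Uniqueₚ.allFin⁺ n)
                      | Allₚ.all-filter (λ w → Boolₚ.T? (adj G v w)) (allFin n)
  other-neighbour (s≤s ()) u | _ ∷ [] | _ | _
  ... | x ∷ y ∷ _ | (x≢y ∷ _) ∷ _ | vx ∷ vy ∷ _ = case (x Finₚ.≟ u) of λ where
    (no x≢u) → x , vx , x≢u
    (yes refl) → y , vy , x≢y ∘ sym

  close-up : ∀ {u v w} A {B} → Unique (u ∷ v ∷ A ++ w ∷ B) → Linked _~_ (u ∷ v ∷ A ++ w ∷ B) → w ~ u →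
    IsCycle G (u ∷ v ∷ A ++ w ∷ [])
  close-up {u} {v} {w} A {B} uniq l wu =
    s≤s (s≤s (ℕₚ.≤-trans (ℕₚ.m≤n+m 1 (length A)) (ℕₚ.≤-reflexive (sym (Listₚ.length-++ A)))))
    , Unique-++⁻ˡ (u ∷ v ∷ A ++ w ∷ []) (subst Unique assoc uniq)
    , Linked-snoc (u ∷ v ∷ A) (Linked-++⁻ˡ (u ∷ v ∷ A ++ w ∷ []) (subst (Linked _~_) assoc l)) wu
    where
    assoc : u ∷ v ∷ A ++ w ∷ B ≡ (u ∷ v ∷ A ++ w ∷ []) ++ B
    assoc = cong (λ l → u ∷ v ∷ l) (sym (Listₚ.++-assoc A _ B))

  -- Extend a path at its first vertex u until u has a neighbour on the path.
  extend : MinDegreeAtLeast2 G → ∀ fuel {u v p} → n < fuel + length (u ∷ v ∷ p) →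
    Unique (u ∷ v ∷ p) → Linked _~_ (u ∷ v ∷ p) → Cycle G
  extend δ zero n< uniq l = ⊥-elim (ℕₚ.<⇒≱ n< (Unique⇒length≤ uniq))
  extend δ (suc fuel) {u} {v} {p} n< uniq l with other-neighbour (δ u) v
  ... | w , uw , w≢v with DecMembership._∈?_ Finₚ._≟_ w (u ∷ v ∷ p)
  ... | yes (here refl) = ⊥-elim (~⇒≢ uw refl)
  ... | yes (there (here refl)) = ⊥-elim (w≢v refl)
  ... | yes (there (there w∈)) with ∈-∃++ w∈
  ... | A , B , refl = _ , close-up A uniq l (~-sym uw)
  extend δ (suc fuel) {u} {v} {p} n< uniq l | w , uw , w≢v | no w∉ =
    extend δ fuel (subst (n <_) (sym (ℕₚ.+-suc fuel _)) n<)
      (All.tabulate (λ x∈ → λ { refl → w∉ x∈ }) ∷ uniq) (~-sym uw ∷ l)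

  minDegree⇒cycle : MinDegreeAtLeast2 G → Fin n → Cycle G
  minDegree⇒cycle δ u with other-neighbour (δ u) u
  ... | w , uw , w≢u = extend δ n (ℕₚ.m<m+n n (s≤s z≤n)) ((w≢u ∷ []) ∷ [] ∷ []) (~-sym uw ∷ [-])

  -- Cycles have at most `n` vertices, so the search is finite; it replaces excluded middle in the
  -- descent to a cycle with fewest high vertices.
  fewer? : ∀ e → Dec (∃ λ (c : Cycle G) → highDegreeOn G (proj₁ c) < e)
  fewer? e = map′ to from (Finₚ.any? λ (l : Fin (suc n)) → any-list? (toℕ l) λ xs → isCycle? xs ×-dec (highDegreeOn G xs ℕₚ.<? e))
    where
    to : (∃ λ (l : Fin (suc n)) → ∃ λ xs → length xs ≡ toℕ l × IsCycle G xs × highDegreeOn G xs < e) →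
      ∃ λ (c : Cycle G) → highDegreeOn G (proj₁ c) < e
    to (_ , xs , _ , cyc , <e) = (xs , cyc) , <e
    from : (∃ λ (c : Cycle G) → highDegreeOn G (proj₁ c) < e) →
      ∃ λ (l : Fin (suc n)) → ∃ λ xs → length xs ≡ toℕ l × IsCycle G xs × highDegreeOn G xs < e
    from ((xs , cyc@(_ , u , _)) , <e) = fromℕ< (s≤s (Unique⇒length≤ u)) , xs
      , sym (Finₚ.toℕ-fromℕ< _) , cyc , <e

  effectiveGirth : Cycle G → ∃ (EffectiveGirth G)
  effectiveGirth c = descend c (<-wellFounded _)
    where
    descend : ∀ c → Acc _<_ (highDegreeOn G (proj₁ c)) → ∃ (EffectiveGirth G)
    descend c (acc rec) with fewer? (highDegreeOn G (proj₁ c))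
    ... | yes (c′ , <e) = descend c′ (rec <e)
    ... | no none = _ , (c , refl) , λ c′ → ℕₚ.≮⇒≥ λ <e → none (c′ , <e)

-- K₄ shows 3 ≤ g(k); some such bound is needed because ℓ(0) > ℓ(1), i.e. ℓ is not monotone at 0.
K₄ : Graph 4
K₄ = record { adj = λ u v → not ⌊ u Finₚ.≟ v ⌋ ; sym = symm ; irrefl = irr }
  where
  symm : ∀ (u v : Fin 4) → not ⌊ u Finₚ.≟ v ⌋ ≡ not ⌊ v Finₚ.≟ u ⌋
  symm u v with u Finₚ.≟ v | v Finₚ.≟ u
  ... | yes _ | yes _ = refl
  ... | no _ | no _ = refl
  ... | yes refl | no v≢u = ⊥-elim (v≢u refl)
  ... | no u≢v | yes refl = ⊥-elim (u≢v refl)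
  irr : ∀ (v : Fin 4) → not ⌊ v Finₚ.≟ v ⌋ ≡ false
  irr v with v Finₚ.≟ v
  ... | yes _ = refl
  ... | no v≢v = ⊥-elim (v≢v refl)

K₄-degree : ∀ v → degree K₄ v ≡ 3
K₄-degree zero = refl
K₄-degree (suc zero) = refl
K₄-degree (suc (suc zero)) = refl
K₄-degree (suc (suc (suc zero))) = refl

-- Two disjoint cycles would need six vertices.
K₄-disjoint : ∀ {k} → 1 ≤ k → AtMostDisjointCycles K₄ k
K₄-disjoint (s≤s _) ((c , 3≤c , uc , _) ∷ (d , 3≤d , ud , _) ∷ _ , _ , ((c∩d=∅ ∷ _) ∷ _)) =
  ℕₚ.<⇒≱ (s≤s (s≤s (s≤s (s≤s (s≤s z≤n))))) (ℕₚ.≤-trans (ℕₚ.+-mono-≤ 3≤c 3≤d)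
    (ℕₚ.≤-trans (ℕₚ.≤-reflexive (sym (Listₚ.length-++ c)))
      (Unique⇒length≤ (Uniqueₚ.++⁺ uc ud λ (p , q) → c∩d=∅ _ p q))))

K₄-effectiveGirth : EffectiveGirth K₄ 3
K₄-effectiveGirth = ((triangle , s≤s (s≤s (s≤s z≤n)) , ((λ ()) ∷ (λ ()) ∷ []) ∷ ((λ ()) ∷ []) ∷ [] ∷ [] , _ ∷ _ ∷ _ ∷ [-]) , refl)
  , λ (c , 3≤c , _) → ℕₚ.≤-trans 3≤c (ℕₚ.≤-reflexive (sym (cong length
      (Listₚ.filter-all _ (All.tabulate {xs = c} λ {v} _ → ℕₚ.≤-reflexive (sym (K₄-degree v)))))))
  where
  triangle : List (Fin 4)
  triangle = zero ∷ suc zero ∷ suc (suc zero) ∷ []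

3≤maxEffGirth : ∀ {k m} → 1 ≤ k → IsMaxEffGirth k m → 3 ≤ m
3≤maxEffGirth 1≤k (_ , max) = max 4 K₄ 3
  (λ v → ℕₚ.≤-trans (s≤s (s≤s z≤n)) (ℕₚ.≤-reflexive (sym (K₄-degree v))))
  (K₄-disjoint 1≤k) K₄-effectiveGirth

-- Monotonicity of the Fibonacci and Lucas numbers

fib-mono-≤ : ∀ {a b} → a ≤ b → fib a ≤ fib b
fib-mono-≤ {b = zero} z≤n = z≤n
fib-mono-≤ {a} {suc b} a≤b with ℕₚ.m≤n⇒m<n∨m≡n a≤b
... | inj₁ (s≤s a≤) = ℕₚ.≤-trans (fib-mono-≤ a≤) (fib-mono b)
... | inj₂ refl = ℕₚ.≤-refl

lucas-mono-≤ : ∀ {a b} → a ≤ b → lucas (suc a) ≤ lucas (suc b)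
lucas-mono-≤ a≤b = ℕₚ.+-mono-≤ (fib-mono-≤ a≤b) (fib-mono-≤ (s≤s (s≤s a≤b)))

1≤lucas : ∀ n → 1 ≤ lucas n
1≤lucas zero = s≤s z≤n
1≤lucas (suc n) = lucas-mono-≤ {0} {n} z≤n

1≤lucasProd : ∀ g k → 1 ≤ lucasProd g k
1≤lucasProd g zero = s≤s z≤n
1≤lucasProd g (suc k) = ℕₚ.*-mono-≤ (1≤lucasProd g k) (1≤lucas (g (suc k)))

-- Cycles within a vertex set as routes

Unique-snoc : ∀ {A : Set} {x : A} xs → Unique (x ∷ xs) → Unique (xs ++ x ∷ [])
Unique-snoc xs (x∉ ∷ u) = Uniqueₚ.++⁺ u ([] ∷ []) λ { (p , here refl) → All.lookup x∉ p refl }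

module _ {n : ℕ} (G : Graph n) where

  rotate₁ : ∀ x xs → IsCycle G (x ∷ xs) → IsCycle G (xs ++ x ∷ [])
  rotate₁ x [] (s≤s () , _)
  rotate₁ x (y ∷ xs) (3≤ , u , r ∷ l) =
    ℕₚ.≤-trans 3≤ (ℕₚ.≤-reflexive (trans (ℕₚ.+-comm 1 _) (sym (Listₚ.length-++ (y ∷ xs)))))
    , Unique-snoc (y ∷ xs) u , Linked-snoc (y ∷ xs) l r

  rotate : ∀ A {B} → IsCycle G (A ++ B) → IsCycle G (B ++ A)
  rotate [] {B} cyc = subst (IsCycle G) (sym (Listₚ.++-identityʳ B)) cyc
  rotate (x ∷ A) {B} cyc = subst (IsCycle G) (Listₚ.++-assoc B (x ∷ []) A)
    (rotate A {B ++ x ∷ []} (subst (IsCycle G) (Listₚ.++-assoc A B (x ∷ [])) (rotate₁ x (A ++ B) cyc)))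

  module _ (W : Fin n → Bool) where

    neighbour? : ∀ v x → Dec (W ∋ x × T (adj G v x))
    neighbour? v x = (W ∋? x) ×-dec Boolₚ.T? (adj G v x)

    neighbours : Fin n → List (Fin n)
    neighbours v = filter (neighbour? v) (allFin n)

    degreeIn : Fin n → ℕ
    degreeIn v = length (neighbours v)

    ∈-neighbours⁺ : ∀ {v x} → W ∋ x → T (adj G v x) → x ∈ neighbours v
    ∈-neighbours⁺ {v} {x} Wx vx = ∈-filter⁺ (neighbour? v) (∈-allFin x) (Wx , vx)

    ∈-neighbours⁻ : ∀ {v x} → x ∈ neighbours v → W ∋ x × T (adj G v x)
    ∈-neighbours⁻ {v} x∈ = proj₂ (∈-filter⁻ (neighbour? v) {xs = allFin n} x∈)

    -- Degrees are taken in `W`, to match the effective girth of the induced graph, and stay fixed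
    -- while the cutting shrinks the vertex set.
    high? : Fin n → Bool
    high? x = does (3 ≤? degreeIn x)

    open Segments high?
    open CycleCut high?
    open Routes G W

    low-neighbours : ∀ {x o t y} → Low x → o ≢ t → W ∋ o → W ∋ t → W ∋ y →
      T (adj G x o) → T (adj G x t) → T (adj G x y) → y ≡ o ⊎ y ≡ t
    low-neighbours {x} {o} {t} {y} lx o≢t Wo Wt Wy xo xt xy with y Finₚ.≟ o | y Finₚ.≟ t
    ... | yes e | _ = inj₁ e
    ... | no _ | yes e = inj₂ e
    ... | no y≢o | no y≢t = case trans (sym lx) (dec-true (3 ≤? degreeIn x) three) of λ ()
      where
      three : 3 ≤ degreeIn x
      three = Unique-⊆⇒length≤ ((o≢t ∷ (y≢o ∘ sym) ∷ []) ∷ ((y≢t ∘ sym) ∷ []) ∷ [] ∷ [])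
        λ { (here refl) → ∈-neighbours⁺ Wo xo
          ; (there (here refl)) → ∈-neighbours⁺ Wt xt
          ; (there (there (here refl))) → ∈-neighbours⁺ Wy xy }

    next∈ : ∀ P {t} → next P t ∈ P ++ t ∷ []
    next∈ [] = here refl
    next∈ (_ ∷ _) = here refl

    next-snoc∈ : ∀ P {t u} → next (P ++ t ∷ []) u ∈ P ++ t ∷ []
    next-snoc∈ [] = here refl
    next-snoc∈ (_ ∷ _) = here refl

    low-closed : ∀ {o P t y z} → Route o P t → y ∈ P → Low y → W ∋ z → adj G y z ≡ true → z ∈ o ∷ P ++ t ∷ []
    low-closed {P = _ ∷ P} (cons nbr _ _ _ _) (here refl) ly Wz yz with nbr ly Wz yz
    ... | inj₁ refl = here refl
    ... | inj₂ refl = there (there (next∈ P))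
    low-closed (cons _ _ _ _ r) (there y∈) ly Wz yz = there (low-closed r y∈ ly Wz yz)

    far : ∀ {a o P t y} → Route o P t → W ∋ a → a ∉ o ∷ P ++ t ∷ [] → y ∈ P → Low y → ¬ adj G a y ≡ true
    far r Wa a∉ y∈ ly ay = a∉ (low-closed r y∈ ly Wa (adj-true-sym G ay))

    -- Only `o ≢ next P t` is demanded of `o`, since the route round the cycle both starts and ends
    -- at `s`.
    route-cons : ∀ {o x P t} → Linked (λ u v → T (adj G u v)) (o ∷ x ∷ P ++ t ∷ []) → o ≢ next P t →
      Unique (x ∷ P ++ t ∷ []) → W ∋ o → All (W ∋_) (x ∷ P ++ t ∷ []) → Route x P t → Route o (x ∷ P) t
    route-cons {P = []} (ox ∷ xt ∷ _) o≢ _ Wo (Wx ∷ Wt ∷ _) r =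
      cons (λ lx Wy xy → low-neighbours lx o≢ Wo Wt Wy (~-sym G ox) xt (≡true⇒T xy)) (λ ()) (λ ()) (λ ()) r
    route-cons {P = p ∷ P} {t} (ox ∷ xp ∷ _) o≢ (x∉ ∷ _) Wo (Wx ∷ Wp ∷ _) r@(cons _ _ _ _ r′) =
      cons (λ lx Wy xy → low-neighbours lx o≢ Wo Wp Wy (~-sym G ox) xp (≡true⇒T xy))
        (λ x∈ → All.lookup x∉ (∈-++⁺ˡ x∈) refl) (λ { (here refl) → T⇒≡true xp })
        (far r′ Wx λ x∈ → All.lookup x∉ x∈ refl) r

    route : ∀ o P {t} → Linked (λ u v → T (adj G u v)) (o ∷ P ++ t ∷ []) → Unique (o ∷ P ++ t ∷ []) →
      All (W ∋_) (o ∷ P ++ t ∷ []) → Route o P t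
    route o [] _ _ _ = []
    route o (x ∷ P) l (o∉ ∷ u) (Wo ∷ Ws) =
      route-cons l (All.lookup o∉ (there (next∈ P))) u Wo Ws (route x P (Linked.tail l) u Ws)

    cut-from : ∀ {X} s P → IsCycle G (s ∷ P) → All (W ∋_) (s ∷ P) →
      (∀ V → V ⊆ᵇ W → (∀ {c} → c ∈ s ∷ P → ¬ V ∋ c) → Tree G V X) →
      ∀ {e} → 3 ≤ e → highs P ≡ 0 ⊎ suc (highs P) ≤ e → Tree G W (lucas e * X)
    cut-from s [] (s≤s () , _)
    cut-from {X} s (x ∷ L) cyc Ws rest {suc e} (s≤s 2≤e) few with initLast L
    cut-from s (x ∷ .[]) (s≤s (s≤s ()) , _) _ _ _ _ | []
    cut-from {X} s (x ∷ .(Q ++ t ∷ [])) (_ , uniq@(s∉ ∷ u) , l) (Ws ∷ WP) rest {suc e} (s≤s 2≤e) few | Q ∷ʳ′ t =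
      zero-or-suc refl few
      where
      P = x ∷ Q ++ t ∷ []
      s∉P : s ∉ P
      s∉P s∈ = All.lookup s∉ s∈ refl
      l′ : Linked (λ u v → T (adj G u v)) ((s ∷ x ∷ Q) ++ t ∷ s ∷ [])
      l′ = subst (Linked _) (cong (λ l → s ∷ x ∷ l) (Listₚ.++-assoc Q _ _)) l
      t~s : ∀ R → Linked (λ u v → T (adj G u v)) (R ++ t ∷ s ∷ []) → T (adj G t s)
      t~s [] (r ∷ _) = r
      t~s (_ ∷ R) l = t~s R (Linked.tail l)
      s~ : ∀ {z} → z ∈ x ∷ [] → adj G s z ≡ true
      s~ (here refl) = T⇒≡true (Linked.head l)
      inner : Route x Q t
      inner = route x Q (Linked-++⁻ˡ P (Linked.tail l)) u WP
      last≢s : s ≢ next (Q ++ t ∷ []) s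
      last≢s s≡ = s∉P (there (subst (_∈ _) (sym s≡) (next-snoc∈ Q)))
      full : Route s P s
      full = route-cons l last≢s (Unique-snoc P uniq) Ws WP∷ʳs (route x (Q ++ t ∷ []) (Linked.tail l) (Unique-snoc P uniq) WP∷ʳs)
        where WP∷ʳs = Allₚ.++⁺ WP (Ws ∷ [])
      zero-or-suc : ∀ {h} → highs P ≡ h → h ≡ 0 ⊎ suc h ≤ suc e → Tree G W (lucas (suc e) * X)
      -- At most `s` is high. The two branches at `s` cost 2 together, which exceeds ℓ(1) = 1 but
      -- not ℓ(3) = 4.
      zero-or-suc {zero} c _ = weaken G (ℕₚ.*-monoˡ-≤ X (ℕₚ.≤-trans (s≤s (s≤s z≤n)) (lucas-mono-≤ 2≤e)))
        (cut-without-high G W X s t (x ∷ Q) rest Ws (All.lookup WP) s∉P (T⇒≡true (~-sym G (t~s (s ∷ x ∷ Q) l′)))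
          s~ (far inner Ws s∉P) full c)
      zero-or-suc {suc h} c (inj₂ (s≤s h<e)) = weaken G (ℕₚ.*-monoˡ-≤ X (lucas-mono-≤ h<e))
        (cut-with-high G W X s t (x ∷ Q) rest Ws (All.lookup WP) s∉P (T⇒≡true (~-sym G (t~s (s ∷ x ∷ Q) l′)))
          s~ (far inner Ws s∉P) full c)

    -- The branching must start at a high vertex if there is one: the Lucas index is then the number
    -- of high vertices on the cycle, `s` included.
    cut-cycle : ∀ {X} c → IsCycle G c → All (W ∋_) c →
      (∀ V → V ⊆ᵇ W → (∀ {v} → v ∈ c → ¬ V ∋ v) → Tree G V X) →
      ∀ {e} → 3 ≤ e → highs c ≤ e → Tree G W (lucas e * X)
    cut-cycle [] (() , _)
    cut-cycle c@(s ∷ P) cyc Wc rest 3≤e ≤e with last-high c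
    ... | inj₁ c₀ = cut-from s P cyc Wc rest 3≤e (inj₁ (ℕₚ.m+n≡0⇒n≡0 (if high? s then 1 else 0) c₀))
    ... | inj₂ (A , z , B , eq , hz , _) = cut-from z (B ++ A)
            (rotate A (subst (IsCycle G) eq cyc))
            (Allₚ.++⁺ (Allₚ.++⁻ʳ A Wc′) (Allₚ.++⁻ˡ A Wc′))
            (λ V V⊆ dead → rest V V⊆ λ v∈ → dead (swap (∈-++⁻ A (subst (_ ∈_) eq v∈))))
            3≤e (inj₂ (ℕₚ.≤-trans (ℕₚ.≤-reflexive count) ≤e))
      where
      Wc′ = subst (All (W ∋_)) eq Wc
      swap : ∀ {v} → v ∈ A ⊎ v ∈ z ∷ B → v ∈ z ∷ B ++ A
      swap (inj₁ v∈) = ∈-++⁺ʳ (z ∷ B) v∈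
      swap (inj₂ v∈) = ∈-++⁺ˡ v∈
      count : suc (highs (B ++ A)) ≡ highs c
      count = trans (sym (count-high {P = B ++ A} hz)) (trans (highs-++ (z ∷ B)) (trans (ℕₚ.+-comm (highs (z ∷ B)) _)
        (trans (sym (highs-++ A)) (cong highs (sym eq)))))

-- Induced subgraphs and the induction

lookup-injective : ∀ {A : Set} {xs : List A} → Unique xs → ∀ {i j} → lookup xs i ≡ lookup xs j → i ≡ j
lookup-injective (x∉ ∷ u) {zero} {zero} _ = refl
lookup-injective (x∉ ∷ u) {zero} {suc j} e = ⊥-elim (All.lookup x∉ (∈-lookup j) e)
lookup-injective (x∉ ∷ u) {suc i} {zero} e = ⊥-elim (All.lookup x∉ (∈-lookup i) (sym e))
lookup-injective (x∉ ∷ u) {suc i} {suc j} e = cong suc (lookup-injective u e)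

highs-map : ∀ {m n} {P : Fin m → Set} (hi : Fin n → Bool) (f : Fin m → Fin n) (P? : ∀ i → Dec (P i)) →
  (∀ i → hi (f i) ≡ does (P? i)) → ∀ c → Segments.highs hi (map f c) ≡ length (filter P? c)
highs-map hi f P? e [] = refl
highs-map hi f P? e (i ∷ c) rewrite highs-map hi f P? e c | e i with does (P? i)
... | true = refl
... | false = refl

module _ {n : ℕ} (G : Graph n) where

  -- Stated with cycles of `G`, so that shrinking `W` needs no renumbering.
  AtMostDisjointCyclesIn : (Fin n → Bool) → ℕ → Set
  AtMostDisjointCyclesIn W k = ¬ Σ (List (Cycle G)) λ cs →
    length cs ≡ suc k × AllPairs (VertexDisjoint G) cs × All (λ c → All (W ∋_) (proj₁ c)) cs

  restrict : ∀ {V W k} → V ⊆ᵇ W → AtMostDisjointCyclesIn W k → AtMostDisjointCyclesIn V k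
  restrict V⊆W few (cs , len , disj , cs⊆) = few (cs , len , disj , All.map (All.map V⊆W) cs⊆)

  remove-cycle : ∀ {V W k} (c : Cycle G) → All (W ∋_) (proj₁ c) → V ⊆ᵇ W → (∀ {v} → v ∈ proj₁ c → ¬ V ∋ v) →
    AtMostDisjointCyclesIn W (suc k) → AtMostDisjointCyclesIn V k
  remove-cycle c c⊆ V⊆W dead few (cs , len , disj , cs⊆) =
    few (c ∷ cs , cong suc len , All.map (λ d⊆ v v∈c v∈d → dead v∈c (All.lookup d⊆ v∈d)) cs⊆ ∷ disj
      , c⊆ ∷ All.map (All.map V⊆W) cs⊆)

  -- The maximality of `g` concerns graphs on some `Fin m`, hence the renumbering of `W`.
  module Induced (W : Fin n → Bool) where

    vertices : List (Fin n)
    vertices = filter (W ∋?_) (allFin n)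

    order : ℕ
    order = length vertices

    vertex : Fin order → Fin n
    vertex = lookup vertices

    vertices-unique : Unique vertices
    vertices-unique = Uniqueₚ.filter⁺ (W ∋?_) (Uniqueₚ.allFin⁺ n)

    vertex∈W : ∀ i → W ∋ vertex i
    vertex∈W i = proj₂ (∈-filter⁻ (W ∋?_) {xs = allFin n} (∈-lookup i))

    vertex-surjective : ∀ {x} → W ∋ x → ∃ λ i → x ≡ vertex i
    vertex-surjective {x} Wx = let x∈ = ∈-filter⁺ (W ∋?_) (∈-allFin x) Wx in index x∈ , Anyₚ.lookup-index x∈

    induced : Graph order
    induced = record
      { adj = λ i j → adj G (vertex i) (vertex j)
      ; sym = λ i j → adj-sym G (vertex i) (vertex j)
      ; irrefl = λ i → irrefl G (vertex i) }

    degree-induced : ∀ i → degree induced i ≡ degreeIn G W (vertex i)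
    degree-induced i = ℕₚ.≤-antisym
      (ℕₚ.≤-trans (ℕₚ.≤-reflexive (sym (Listₚ.length-map vertex N)))
        (Unique-⊆⇒length≤ (Uniqueₚ.map⁺ (lookup-injective vertices-unique)
            (Uniqueₚ.filter⁺ N? (Uniqueₚ.allFin⁺ order))) ⊆₁))
      (ℕₚ.≤-trans (Unique-⊆⇒length≤ (Uniqueₚ.filter⁺ (neighbour? G W (vertex i)) (Uniqueₚ.allFin⁺ n)) ⊆₂)
        (ℕₚ.≤-reflexive (Listₚ.length-map vertex N)))
      where
      N? : ∀ j → Dec (T (adj G (vertex i) (vertex j)))
      N? j = Boolₚ.T? _
      N = filter N? (allFin order)
      ⊆₁ : ∀ {x} → x ∈ map vertex N → x ∈ neighbours G W (vertex i)
      ⊆₁ x∈ with ∈-map⁻ vertex x∈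
      ... | j , j∈ , refl = ∈-neighbours⁺ G W (vertex∈W j) (proj₂ (∈-filter⁻ N? {xs = allFin order} j∈))
      ⊆₂ : ∀ {x} → x ∈ neighbours G W (vertex i) → x ∈ map vertex N
      ⊆₂ x∈ with ∈-neighbours⁻ G W x∈
      ... | Wx , ix with vertex-surjective Wx
      ... | j , refl = ∈-map⁺ vertex (∈-filter⁺ N? (∈-allFin j) ix)

    lift-cycle : ∀ {c} → IsCycle induced c → IsCycle G (map vertex c)
    lift-cycle {c} (3≤ , u , l) = ℕₚ.≤-trans 3≤ (ℕₚ.≤-reflexive (sym (Listₚ.length-map vertex c)))
      , Uniqueₚ.map⁺ (lookup-injective vertices-unique) u
      , subst (Linked _) (trans (Listₚ.map-++ vertex c _) (cong (map vertex c ++_) (sym (Listₚ.take-map 1 c)))) (Linkedₚ.map⁺ l)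

    lifted⊆W : ∀ c → All (W ∋_) (map vertex c)
    lifted⊆W c = Allₚ.map⁺ (All.tabulate λ {i} _ → vertex∈W i)

    few-cycles-induced : ∀ {k} → AtMostDisjointCyclesIn W k → AtMostDisjointCycles induced k
    few-cycles-induced few (cs , len , disj) = few (map lift cs , trans (Listₚ.length-map lift cs) len
      , AllPairsₚ.map⁺ (AllPairs.map (λ {c} {d} → disjoint {c} {d}) disj)
      , Allₚ.map⁺ (All.tabulate λ {c} _ → lifted⊆W (proj₁ c)))
      where
      lift : Cycle induced → Cycle G
      lift (c , cyc) = map vertex c , lift-cycle cyc
      disjoint : ∀ {c d} → VertexDisjoint induced c d → VertexDisjoint G (lift c) (lift d)
      disjoint c∩d=∅ v v∈c v∈d with ∈-map⁻ vertex v∈c | ∈-map⁻ vertex v∈d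
      ... | i , i∈c , refl | j , j∈d , e = c∩d=∅ i i∈c (subst (_∈ _) (sym (lookup-injective vertices-unique e)) j∈d)

    highs-lifted : ∀ c → Segments.highs (high? G W) (map vertex c) ≡ highDegreeOn induced c
    highs-lifted c = highs-map (high? G W) vertex (λ i → 3 ≤? degree induced i)
      (λ i → cong (λ d → does (3 ≤? d)) (sym (degree-induced i))) c

  order-link : ∀ {W b} → W ∋ b → Induced.order (link G b W) < Induced.order W
  order-link {W} {b} Wb = Unique-⊆⇒length≤
    (All.tabulate (λ x∈ → λ { refl → proj₁ (proj₂ (link⁻ G {W = W} (proj₂ (∈⁻ x∈)))) refl })
      ∷ Induced.vertices-unique (link G b W))
    λ { (here refl) → ∈-filter⁺ (W ∋?_) (∈-allFin b) Wb
      ; {x} (there x∈) → ∈-filter⁺ (W ∋?_) (∈-allFin x) (proj₁ (link⁻ G {W = W} (proj₂ (∈⁻ x∈)))) }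
    where
    ∈⁻ : ∀ {x} → x ∈ Induced.vertices (link G b W) → x ∈ allFin n × link G b W ∋ x
    ∈⁻ = ∈-filter⁻ (link G b W ∋?_) {xs = allFin n}

  -- The recursion is lexicographic: `size` drops when a leaf is removed, and starts afresh when a
  -- cycle is cut and `k` drops.
  tree : ∀ k (g : ℕ → ℕ) → (∀ j → 1 ≤ j → j ≤ k → IsMaxEffGirth j (g j)) →
    ∀ size W → Induced.order W ≤ size → AtMostDisjointCyclesIn W k → Tree G W (lucasProd g k)
  tree k g max size W ≤size few with Finₚ.any? (λ v → (W ∋? v) ×-dec ¬? (2 ≤? degreeIn G W v))
  ... | yes (v , Wv , deg<2) = low-degree size ≤size (neighbours G W v) refl
    where
    low-degree : ∀ size → Induced.order W ≤ size → ∀ N → neighbours G W v ≡ N → Tree G W (lucasProd g k)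
    low-degree size ≤size [] eq = isolated v Wv λ Wx vx →
      case subst (_ ∈_) eq (∈-neighbours⁺ G W Wx (≡true⇒T vx)) of λ ()
    low-degree size ≤size (_ ∷ _ ∷ _) eq = ⊥-elim (deg<2 (subst (2 ≤_) (cong length (sym eq)) (s≤s (s≤s z≤n))))
    low-degree size ≤size (b ∷ []) eq with ∈-neighbours⁻ G W (subst (b ∈_) (sym eq) (here refl))
    ... | Wb , vb = leaf G Wv Wb (T⇒≡true vb) only (shrink size ≤size)
      where
      only : ∀ {x} → W ∋ x → adj G v x ≡ true → x ≡ b
      only Wx vx with subst (_ ∈_) eq (∈-neighbours⁺ G W Wx (≡true⇒T vx))
      ... | here e = e
      shrink : ∀ size → Induced.order W ≤ size → Tree G (link G b W) (lucasProd g k)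
      shrink zero ≤size = case ℕₚ.≤-trans (order-link Wb) ≤size of λ ()
      shrink (suc size) ≤size = tree k g max size (link G b W) (ℕₚ.≤-pred (ℕₚ.≤-trans (order-link Wb) ≤size))
        (restrict {link G b W} {W} (λ p → proj₁ (link⁻ G {W = W} p)) few)
  tree k g max size W ≤size few | no none with Finₚ.any? (W ∋?_)
  ... | no empty = void (λ x Wx → empty (x , Wx)) (1≤lucasProd g k)
  ... | yes (x , Wx) = cut k max few
    where
    open Induced W
    δ : MinDegreeAtLeast2 induced
    δ i with 2 ≤? degreeIn G W (vertex i)
    ... | yes 2≤ = subst (2 ≤_) (sym (degree-induced i)) 2≤
    ... | no 2≰ = ⊥-elim (none (vertex i , vertex∈W i , 2≰))
    c₀ : Cycle induced
    c₀ = minDegree⇒cycle induced δ (proj₁ (vertex-surjective Wx))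
    cut : ∀ k → (∀ j → 1 ≤ j → j ≤ k → IsMaxEffGirth j (g j)) → AtMostDisjointCyclesIn W k → Tree G W (lucasProd g k)
    cut zero max few = ⊥-elim (few-cycles-induced few (c₀ ∷ [] , refl , [] ∷ []))
    cut (suc k) max few with effectiveGirth induced c₀
    ... | e , girth@((c , high≡e) , _) = subst (Tree G W) (ℕₚ.*-comm (lucas (g (suc k))) _)
      (cut-cycle G W (map vertex (proj₁ c)) (lift-cycle (proj₂ c)) (lifted⊆W (proj₁ c))
        (λ V V⊆W dead → tree k g (λ j 1≤j j≤k → max j 1≤j (ℕₚ.m≤n⇒m≤1+n j≤k)) (Induced.order V) V ℕₚ.≤-refl
          (remove-cycle {V} {W} (_ , lift-cycle (proj₂ c)) (lifted⊆W (proj₁ c)) V⊆W dead few))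
        (3≤maxEffGirth (s≤s z≤n) gmax)
        -- The graph induced on `W` competes in the maximum `g (suc k)`, which therefore bounds its
        -- effective girth.
        (subst (_≤ g (suc k)) (sym (trans (highs-lifted (proj₁ c)) high≡e))
          (proj₂ gmax order induced e δ (few-cycles-induced few) girth)))
      where gmax = max (suc k) (s≤s z≤n) ℕₚ.≤-refl

theorem3p5 : (k : ℕ) (g : ℕ → ℕ) →
    (∀ j → 1 ≤ j → j ≤ k → IsMaxEffGirth j (g j)) →
    (n : ℕ) (G : Graph n) → AtMostDisjointCycles G k →
    cBoundedBy G (lucasProd g k)
theorem3p5 k g max n G few = tree⇒cBoundedBy G (tree G k g max _ (λ _ → true) ℕₚ.≤-refl
  λ (cs , len , disj , _) → few (cs , len , disj))
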